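{- Let $n\ge2$, let $A,B_1,\ldots,B_n,C_1,\ldots,C_n\in\widehat{\mathbb F_q}$ and $x_1,\ldots,x_n\in\mathbb F_q$. Let $k,l\in\{1,\ldots,n\}$ with $k\neq l$ and $x_l\ne0$. Then $$\begin{aligned}F_A^{(n)}&\left[A;B_1,\ldots,B_n;C_1,\ldots,C_n\mid x_1,\ldots,x_n\right]\\&=\frac{B_kC_k(-1)}{q}\,\overline{B_k}C_k(x_k-1)\,\overline{C_k}(x_k)\,\overline{A}(-x_l)\,C_l(-1)\;F_A^{(n-1)}\left[A;(B_i')_{i\ne k};(C_i)_{i\neq k}\mid (y_i)_{i\neq k}\right]\\&\quad+\frac{B_kC_k(-1)\,\overline{C_k}(x_k)}{q}\sum_{t_k\in\mathbb F_q}A\overline{C_k}(t_k)\,B_k(t_k-1)\,\overline{B_k}C_k(1-t_k+x_kt_k)\;F_A^{(n-1)}\left[A;(B_i)_{i\ne k};(C_i)_{i\ne k}\mid (x_it_k)_{i\ne k}\right],\end{aligned}$$ where $B_l'=\overline{B_l}C_l$ and $B_i'=B_i$ for $i\ne k,l$, while $y_l=1$ and $y_i=-x_i/x_l$ for $i\neq k,l$, and all lists $(\cdot)_{i\ne k}$ are indexed by $i\in\{1,\ldots,n\}\setminus\{k\}$ in increasing order.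
   Context: Let $p$ be an odd prime, $q=p^r$ with $r\ge1$, and $\mathbb F_q$ the field with $q$ elements. $\widehat{\mathbb F_q}$ is the group of multiplicative characters $\chi:\mathbb F_q^\times\to\mathbb C^\times$, each extended to $\mathbb F_q$ by $\chi(0)=0$ (including the trivial character $\epsilon$, so $\epsilon(0)=0$ and $\epsilon(x)=1$ for $x\neq0$). $\overline{\chi}$ is the inverse of $\chi$, and products of characters are pointwise, e.g. $\overline{B}C(x)=\overline{B}(x)C(x)$. For each $m\ge1$ the finite field Lauricella series is (the subscript $A$ in $F_A^{(m)}$ is part of the name) $$F_A^{(m)}\left[A;B_1,\ldots,B_m;C_1,\ldots,C_m\mid x_1,\ldots,x_m\right]=\sum_{t_1,\ldots,t_m\in\mathbb F_q}\left(\prod_{i=1}^m\epsilon(x_i)\frac{B_iC_i(-1)}{q}B_i(t_i)\overline{B_i}C_i(1-t_i)\right)\overline{A}(1-x_1t_1-\cdots-x_mt_m).$$ -}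

module Defs where

open import Algebra.Bundles using (AbelianGroup; Group; CommutativeMonoid; CommutativeRing)
open import Algebra.Definitions using (Invertible)
open import Algebra.Morphism.Bundles using (GroupHomomorphism)
import Algebra.Properties.AbelianGroup as AbelianGroupProperties
import Algebra.Properties.CommutativeSemigroup as CommutativeSemigroupProperties
import Algebra.Properties.CommutativeMonoid.Sum as CommutativeMonoidSum
open import Data.Fin.Base using (Fin)
import Data.Fin.Properties as Fin
open import Data.Integer.Base using (+_)
open import Data.Nat.Base as ℕ using (ℕ; zero; suc)
import Data.Nat.Properties as ℕ
open import Data.Product.Base using (Σ; ∃-syntax; _×_; _,_; proj₁; proj₂)
open import Data.Rational.Base as ℚ using (ℚ; 0ℚ; 1ℚ; ½; ∣_∣)
import Data.Rational.Properties as ℚ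
open import Data.Rational.Solver using (module +-*-Solver)
open import Data.Vec.Functional using (Vector; []; _∷_)
open import Function.Bundles using (Inverse)
open import Function.Properties.Inverse using (Inverse⇒Injection)
open import Level using (Level; 0ℓ; _⊔_) renaming (suc to lsuc)
open import Relation.Binary.Definitions using (Decidable)
open import Relation.Binary.PropositionalEquality as ≡ using (_≡_)
open import Relation.Nullary using (¬_; yes; no)
open import Relation.Nullary.Decidable using (via-injection)

Seq : Set
Seq = ℕ → ℚ

-- x ~ y says that x and y are Cauchy sequences with the same limit:
-- reflexivity of x is the Cauchy condition, and between Cauchy
-- sequences the relation is "the difference tends to 0".
infix 4 _~_
_~_ : Seq → Seq → Set
x ~ y = ∀ {ε} → 0ℚ ℚ.< ε →
        ∃[ N ] (∀ {m n} → N ℕ.≤ m → N ℕ.≤ n → ∣ x m ℚ.- y n ∣ ℚ.< ε)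

private

  half-pos : ∀ {ε} → 0ℚ ℚ.< ε → 0ℚ ℚ.< ½ ℚ.* ε
  half-pos {ε} ε>0 = ℚ.positive⁻¹ (½ ℚ.* ε)
    {{ℚ.pos*pos⇒pos ½ ε {{ℚ.positive ε>0}}}}

  half-sum : ∀ ε → ½ ℚ.* ε ℚ.+ ½ ℚ.* ε ≡ ε
  half-sum ε = ≡.trans (≡.sym (ℚ.*-distribʳ-+ ε ½ ½)) (ℚ.*-identityˡ ε)

  ∣+∣<halves : ∀ {a b c ε} → a ≡ b ℚ.+ c →
               ∣ b ∣ ℚ.< ½ ℚ.* ε → ∣ c ∣ ℚ.< ½ ℚ.* ε → ∣ a ∣ ℚ.< ε
  ∣+∣<halves {b = b} {c} {ε} ≡.refl b< c< = ℚ.≤-<-trans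
    (ℚ.∣p+q∣≤∣p∣+∣q∣ b c)
    (≡.subst (∣ b ∣ ℚ.+ ∣ c ∣ ℚ.<_) (half-sum ε) (ℚ.+-mono-< b< c<))

  module _ {M N : ℕ} where
    ⊔ˡ : ∀ {n} → M ℕ.⊔ N ℕ.≤ n → M ℕ.≤ n
    ⊔ˡ = ℕ.m⊔n≤o⇒m≤o M N

    ⊔ʳ : ∀ {n} → M ℕ.⊔ N ℕ.≤ n → N ℕ.≤ n
    ⊔ʳ = ℕ.m⊔n≤o⇒n≤o M N

  open +-*-Solver using (solve; _:=_; _:+_; _:*_; _:-_; :-_; con)

  ∣-∣-swap : ∀ a b → ∣ a ℚ.- b ∣ ≡ ∣ b ℚ.- a ∣
  ∣-∣-swap a b = ≡.trans
    (≡.cong ∣_∣ (solve 2 (λ a b → a :- b := :- (b :- a)) ≡.refl a b))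
    (ℚ.∣-p∣≡∣p∣ (b ℚ.- a))

  ~-sym : ∀ {x y} → x ~ y → y ~ x
  ~-sym {x} {y} x~y ε>0 with x~y ε>0
  ... | N , close = N , λ {m} {n} m≥ n≥ →
    ≡.subst (ℚ._< _) (∣-∣-swap (x n) (y m)) (close n≥ m≥)

  ~-trans : ∀ {x y z} → x ~ y → y ~ z → x ~ z
  ~-trans {x} {y} {z} x~y y~z ε>0
    with x~y (half-pos ε>0) | y~z (half-pos ε>0)
  ... | M , p | N , q = M ℕ.⊔ N , λ {m} {n} m≥ n≥ →
    ∣+∣<halves
      (solve 3 (λ a b c → a :- c := (a :- b) :+ (b :- c)) ≡.refl (x m) (y m) (z n))
      (p (⊔ˡ m≥) (⊔ˡ m≥)) (q (⊔ʳ {M} m≥) (⊔ʳ {M} n≥))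

  ~-+ : ∀ {x x′ y y′} → x ~ x′ → y ~ y′ →
        (λ n → x n ℚ.+ y n) ~ (λ n → x′ n ℚ.+ y′ n)
  ~-+ {x} {x′} {y} {y′} x~x′ y~y′ ε>0
    with x~x′ (half-pos ε>0) | y~y′ (half-pos ε>0)
  ... | M , p | N , q = M ℕ.⊔ N , λ {m} {n} m≥ n≥ →
    ∣+∣<halves
      (solve 4 (λ a a′ b b′ → (a :+ b) :- (a′ :+ b′) := (a :- a′) :+ (b :- b′))
        ≡.refl (x m) (x′ n) (y m) (y′ n))
      (p (⊔ˡ m≥) (⊔ˡ n≥)) (q (⊔ʳ {M} m≥) (⊔ʳ {M} n≥))

  ~-neg : ∀ {x x′} → x ~ x′ → (λ n → ℚ.- x n) ~ (λ n → ℚ.- x′ n)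
  ~-neg {x} {x′} x~x′ ε>0 with x~x′ ε>0
  ... | N , p = N , λ {m} {n} m≥ n≥ →
    ≡.subst (ℚ._< _)
      (≡.trans (∣-∣-swap (x m) (x′ n))
        (≡.cong ∣_∣ (solve 2 (λ a b → b :- a := (:- a) :- (:- b)) ≡.refl (x m) (x′ n))))
      (p m≥ n≥)

  bounded : ∀ {x y} → x ~ y →
            ∃[ K ] (0ℚ ℚ.< K × ∃[ N ] (∀ {n} → N ℕ.≤ n → ∣ x n ∣ ℚ.≤ K))
  bounded {x} {y} x~y with x~y (ℚ.positive⁻¹ 1ℚ)
  ... | N , p = K , K>0 , N , λ {n} n≥ → begin
      ∣ x n ∣                        ≡⟨ ≡.cong ∣_∣ (solve 2 (λ a b → a := (a :- b) :+ b) ≡.refl (x n) (y N)) ⟩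
      ∣ (x n ℚ.- y N) ℚ.+ y N ∣      ≤⟨ ℚ.∣p+q∣≤∣p∣+∣q∣ (x n ℚ.- y N) (y N) ⟩
      ∣ x n ℚ.- y N ∣ ℚ.+ ∣ y N ∣    ≤⟨ ℚ.+-monoˡ-≤ ∣ y N ∣ (ℚ.<⇒≤ (p n≥ ℕ.≤-refl)) ⟩
      1ℚ ℚ.+ ∣ y N ∣                 ∎
    where
    open ℚ.≤-Reasoning
    K = 1ℚ ℚ.+ ∣ y N ∣
    K>0 : 0ℚ ℚ.< K
    K>0 = ℚ.+-mono-<-≤ (ℚ.positive⁻¹ 1ℚ) (ℚ.0≤∣p∣ (y N))

  quotient : ∀ {K ε} → 0ℚ ℚ.< K → 0ℚ ℚ.< ε → ∃[ δ ] (0ℚ ℚ.< δ × K ℚ.* δ ≡ ε)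
  quotient {K} {ε} K>0 ε>0 = 1/K ℚ.* ε , δ>0 , (begin
      K ℚ.* (1/K ℚ.* ε)    ≡⟨ ℚ.*-assoc K 1/K ε ⟨
      (K ℚ.* 1/K) ℚ.* ε    ≡⟨ ≡.cong (ℚ._* ε) (ℚ.*-inverseʳ K) ⟩
      1ℚ ℚ.* ε             ≡⟨ ℚ.*-identityˡ ε ⟩
      ε                    ∎)
    where
    open ≡.≡-Reasoning
    instance
      _ = ℚ.positive K>0
      _ = ℚ.positive ε>0
      _ = ℚ.pos⇒nonZero K
      _ = ℚ.1/pos⇒pos K
    1/K = ℚ.1/ K
    δ>0 : 0ℚ ℚ.< 1/K ℚ.* ε
    δ>0 = ℚ.positive⁻¹ (1/K ℚ.* ε) {{ℚ.pos*pos⇒pos 1/K ε}}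

  ∣*∣< : ∀ {a b K δ ε} → 0ℚ ℚ.< K → K ℚ.* δ ≡ ε →
         ∣ a ∣ ℚ.≤ K → ∣ b ∣ ℚ.< δ → ∣ a ℚ.* b ∣ ℚ.< ε
  ∣*∣< {a} {b} {K} {δ} K>0 ≡.refl a≤K b<δ = begin-strict
      ∣ a ℚ.* b ∣         ≡⟨ ℚ.∣p*q∣≡∣p∣*∣q∣ a b ⟩
      ∣ a ∣ ℚ.* ∣ b ∣     ≤⟨ ℚ.*-monoʳ-≤-nonNeg ∣ b ∣ {{ℚ.∣-∣-nonNeg b}} a≤K ⟩
      K ℚ.* ∣ b ∣         <⟨ ℚ.*-monoʳ-<-pos K {{ℚ.positive K>0}} b<δ ⟩
      K ℚ.* δ             ∎
    where open ℚ.≤-Reasoning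

  mul-diff : ∀ a a′ b b′ →
             a ℚ.* b ℚ.- a′ ℚ.* b′ ≡ a ℚ.* (b ℚ.- b′) ℚ.+ b′ ℚ.* (a ℚ.- a′)
  mul-diff = solve 4 (λ a a′ b b′ →
    (a :* b) :- (a′ :* b′) := (a :* (b :- b′)) :+ (b′ :* (a :- a′))) ≡.refl

  mul-close : ∀ {a a′ b b′ K L δ η ε} → 0ℚ ℚ.< K → 0ℚ ℚ.< L →
              K ℚ.* δ ≡ ½ ℚ.* ε → L ℚ.* η ≡ ½ ℚ.* ε →
              ∣ a ∣ ℚ.≤ K → ∣ b′ ∣ ℚ.≤ L →
              ∣ a ℚ.- a′ ∣ ℚ.< η → ∣ b ℚ.- b′ ∣ ℚ.< δ →
              ∣ a ℚ.* b ℚ.- a′ ℚ.* b′ ∣ ℚ.< ε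
  mul-close {a} {a′} {b} {b′} K>0 L>0 Kδ Lη a≤K b′≤L p q =
    ∣+∣<halves (mul-diff a a′ b b′)
      (∣*∣< {a} {b ℚ.- b′} K>0 Kδ a≤K q) (∣*∣< {b′} {a ℚ.- a′} L>0 Lη b′≤L p)

  ~-* : ∀ {x x′ y y′} → x ~ x′ → y ~ y′ →
        (λ n → x n ℚ.* y n) ~ (λ n → x′ n ℚ.* y′ n)
  ~-* {x} {x′} {y} {y′} x~x′ y~y′ {ε} ε>0 =
    let K , K>0 , N₁ , x≤K  = bounded {x} {x′} x~x′
        L , L>0 , N₂ , y′≤L = bounded {y′} {y} (~-sym {y} {y′} y~y′)
        δ , δ>0 , Kδ        = quotient K>0 (half-pos ε>0)
        η , η>0 , Lη        = quotient L>0 (half-pos ε>0)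
        N₃ , p              = x~x′ η>0
        N₄ , q              = y~y′ δ>0
    in (N₁ ℕ.⊔ N₂) ℕ.⊔ (N₃ ℕ.⊔ N₄) , λ {m} {n} m≥ n≥ →
      mul-close {x m} {x′ n} {y m} {y′ n} {K} {L} {δ} {η} {ε} K>0 L>0 Kδ Lη
        (x≤K (⊔ˡ (⊔ˡ m≥)))
        (y′≤L (⊔ʳ {N₁} (⊔ˡ n≥)))
        (p (⊔ˡ (⊔ʳ {N₁ ℕ.⊔ N₂} m≥)) (⊔ˡ (⊔ʳ {N₁ ℕ.⊔ N₂} n≥)))
        (q (⊔ʳ {N₃} (⊔ʳ {N₁ ℕ.⊔ N₂} m≥)) (⊔ʳ {N₃} (⊔ʳ {N₁ ℕ.⊔ N₂} n≥)))

-- No η for ℝ and ℂ: sums and products then unify without being unfolded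
-- to sequences.
record ℝ : Set where
  no-eta-equality
  field
    seq    : Seq
    cauchy : seq ~ seq

open ℝ

infix  4 _≈ᴿ_
infixl 6 _+ᴿ_
infixl 7 _*ᴿ_
infix  8 -ᴿ_

-- A record, so that the two reals can be inferred from the equation.
record _≈ᴿ_ (x y : ℝ) : Set where
  constructor same-limit
  field limit : seq x ~ seq y

open _≈ᴿ_

_+ᴿ_ _*ᴿ_ : ℝ → ℝ → ℝ
(x +ᴿ y) .seq n  = seq x n ℚ.+ seq y n
(x +ᴿ y) .cauchy = ~-+ {seq x} {seq x} {seq y} {seq y} (cauchy x) (cauchy y)
(x *ᴿ y) .seq n  = seq x n ℚ.* seq y n
(x *ᴿ y) .cauchy = ~-* {seq x} {seq x} {seq y} {seq y} (cauchy x) (cauchy y)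

-ᴿ_ : ℝ → ℝ
(-ᴿ x) .seq n  = ℚ.- seq x n
(-ᴿ x) .cauchy = ~-neg {seq x} {seq x} (cauchy x)

ratᴿ : ℚ → ℝ
ratᴿ r .seq _ = r
ratᴿ r .cauchy {ε} ε>0 = 0 , λ _ _ →
  ≡.subst (λ d → ∣ d ∣ ℚ.< ε) (≡.sym (ℚ.+-inverseʳ r)) ε>0

private
  pointwise : ∀ {x y} → (∀ n → seq x n ≡ seq y n) → x ≈ᴿ y
  pointwise {x} x≗y .limit ε>0 with cauchy x ε>0
  ... | N , p = N , λ {m} {n} m≥ n≥ →
    ≡.subst (λ z → ∣ seq x m ℚ.- z ∣ ℚ.< _) (x≗y n) (p m≥ n≥)

  reflᴿ : ∀ {x} → x ≈ᴿ x
  reflᴿ {x} = same-limit (cauchy x)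

  symᴿ : ∀ {x y} → x ≈ᴿ y → y ≈ᴿ x
  symᴿ {x} {y} p = same-limit (~-sym {seq x} {seq y} (limit p))

  transᴿ : ∀ {x y z} → x ≈ᴿ y → y ≈ᴿ z → x ≈ᴿ z
  transᴿ {x} {y} {z} p q = same-limit (~-trans {seq x} {seq y} {seq z} (limit p) (limit q))

  +-congᴿ : ∀ {x x′ y y′} → x ≈ᴿ x′ → y ≈ᴿ y′ → x +ᴿ y ≈ᴿ x′ +ᴿ y′
  +-congᴿ {x} {x′} {y} {y′} p q =
    same-limit (~-+ {seq x} {seq x′} {seq y} {seq y′} (limit p) (limit q))

  *-congᴿ : ∀ {x x′ y y′} → x ≈ᴿ x′ → y ≈ᴿ y′ → x *ᴿ y ≈ᴿ x′ *ᴿ y′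
  *-congᴿ {x} {x′} {y} {y′} p q =
    same-limit (~-* {seq x} {seq x′} {seq y} {seq y′} (limit p) (limit q))

  neg-congᴿ : ∀ {x x′} → x ≈ᴿ x′ → -ᴿ x ≈ᴿ -ᴿ x′
  neg-congᴿ {x} {x′} p = same-limit (~-neg {seq x} {seq x′} (limit p))

record ℂ : Set where
  no-eta-equality
  field
    re im : ℝ

open ℂ

infix 4 _≈ᶜ_
record _≈ᶜ_ (z w : ℂ) : Set where
  constructor _,_
  field
    re-≈ : re z ≈ᴿ re w
    im-≈ : im z ≈ᴿ im w

open _≈ᶜ_

infixl 6 _+ᶜ_
infixl 7 _*ᶜ_
infix  8 -ᶜ_

_+ᶜ_ _*ᶜ_ : ℂ → ℂ → ℂ
(z +ᶜ w) .re = re z +ᴿ re w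
(z +ᶜ w) .im = im z +ᴿ im w
(z *ᶜ w) .re = re z *ᴿ re w +ᴿ -ᴿ (im z *ᴿ im w)
(z *ᶜ w) .im = re z *ᴿ im w +ᴿ im z *ᴿ re w

-ᶜ_ : ℂ → ℂ
(-ᶜ z) .re = -ᴿ re z
(-ᶜ z) .im = -ᴿ im z

ratᶜ : ℚ → ℂ
ratᶜ r .re = ratᴿ r
ratᶜ r .im = ratᴿ 0ℚ

0ᶜ 1ᶜ : ℂ
0ᶜ = ratᶜ 0ℚ
1ᶜ = ratᶜ 1ℚ

private
  module Laws where
    assoc⁺ : ∀ z w v → (z +ᶜ w) +ᶜ v ≈ᶜ z +ᶜ (w +ᶜ v)
    assoc⁺ z w v =
        pointwise (λ n → ℚ.+-assoc (seq (re z) n) (seq (re w) n) (seq (re v) n))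
      , pointwise (λ n → ℚ.+-assoc (seq (im z) n) (seq (im w) n) (seq (im v) n))

    comm⁺ : ∀ z w → z +ᶜ w ≈ᶜ w +ᶜ z
    comm⁺ z w = pointwise (λ n → ℚ.+-comm (seq (re z) n) (seq (re w) n))
              , pointwise (λ n → ℚ.+-comm (seq (im z) n) (seq (im w) n))

    identity⁺ : ∀ z → 0ᶜ +ᶜ z ≈ᶜ z
    identity⁺ z = pointwise (λ n → ℚ.+-identityˡ (seq (re z) n))
                , pointwise (λ n → ℚ.+-identityˡ (seq (im z) n))

    inverse⁺ : ∀ z → (-ᶜ z) +ᶜ z ≈ᶜ 0ᶜ
    inverse⁺ z = pointwise (λ n → ℚ.+-inverseˡ (seq (re z) n))
               , pointwise (λ n → ℚ.+-inverseˡ (seq (im z) n))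

    assoc* : ∀ z w v → (z *ᶜ w) *ᶜ v ≈ᶜ z *ᶜ (w *ᶜ v)
    assoc* z w v =
        pointwise (λ n → solve 6 (λ a b c d e f →
          (a :* c :+ :- (b :* d)) :* e :+ :- ((a :* d :+ b :* c) :* f) :=
          a :* (c :* e :+ :- (d :* f)) :+ :- (b :* (c :* f :+ d :* e)))
          ≡.refl (seq (re z) n) (seq (im z) n) (seq (re w) n) (seq (im w) n) (seq (re v) n) (seq (im v) n))
      , pointwise (λ n → solve 6 (λ a b c d e f →
          (a :* c :+ :- (b :* d)) :* f :+ (a :* d :+ b :* c) :* e :=
          a :* (c :* f :+ d :* e) :+ b :* (c :* e :+ :- (d :* f)))
          ≡.refl (seq (re z) n) (seq (im z) n) (seq (re w) n) (seq (im w) n) (seq (re v) n) (seq (im v) n))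

    comm* : ∀ z w → z *ᶜ w ≈ᶜ w *ᶜ z
    comm* z w =
        pointwise (λ n → solve 4 (λ a b c d →
          a :* c :+ :- (b :* d) := c :* a :+ :- (d :* b))
          ≡.refl (seq (re z) n) (seq (im z) n) (seq (re w) n) (seq (im w) n))
      , pointwise (λ n → solve 4 (λ a b c d →
          a :* d :+ b :* c := c :* b :+ d :* a)
          ≡.refl (seq (re z) n) (seq (im z) n) (seq (re w) n) (seq (im w) n))

    identity* : ∀ z → 1ᶜ *ᶜ z ≈ᶜ z
    identity* z =
        pointwise (λ n → solve 2 (λ a b →
          con 1ℚ :* a :+ :- (con 0ℚ :* b) := a) ≡.refl (seq (re z) n) (seq (im z) n))
      , pointwise (λ n → solve 2 (λ a b →
          con 1ℚ :* b :+ con 0ℚ :* a := b) ≡.refl (seq (re z) n) (seq (im z) n))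

    distrib : ∀ z w v → z *ᶜ (w +ᶜ v) ≈ᶜ z *ᶜ w +ᶜ z *ᶜ v
    distrib z w v =
        pointwise (λ n → solve 6 (λ a b c d e f →
          a :* (c :+ e) :+ :- (b :* (d :+ f)) :=
          (a :* c :+ :- (b :* d)) :+ (a :* e :+ :- (b :* f)))
          ≡.refl (seq (re z) n) (seq (im z) n) (seq (re w) n) (seq (im w) n) (seq (re v) n) (seq (im v) n))
      , pointwise (λ n → solve 6 (λ a b c d e f →
          a :* (d :+ f) :+ b :* (c :+ e) :=
          (a :* d :+ b :* c) :+ (a :* f :+ b :* e))
          ≡.refl (seq (re z) n) (seq (im z) n) (seq (re w) n) (seq (im w) n) (seq (re v) n) (seq (im v) n))

    trans : ∀ {z w v} → z ≈ᶜ w → w ≈ᶜ v → z ≈ᶜ v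
    trans p q = transᴿ (re-≈ p) (re-≈ q) , transᴿ (im-≈ p) (im-≈ q)

    cong⁺ : ∀ {z z′ w w′} → z ≈ᶜ z′ → w ≈ᶜ w′ → z +ᶜ w ≈ᶜ z′ +ᶜ w′
    cong⁺ p q = +-congᴿ (re-≈ p) (re-≈ q) , +-congᴿ (im-≈ p) (im-≈ q)

    cong* : ∀ {z z′ w w′} → z ≈ᶜ z′ → w ≈ᶜ w′ → z *ᶜ w ≈ᶜ z′ *ᶜ w′
    cong* p q =
        +-congᴿ (*-congᴿ (re-≈ p) (re-≈ q)) (neg-congᴿ (*-congᴿ (im-≈ p) (im-≈ q)))
      , +-congᴿ (*-congᴿ (re-≈ p) (im-≈ q)) (*-congᴿ (im-≈ p) (re-≈ q))

ℂ-commutativeRing : CommutativeRing 0ℓ 0ℓ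
ℂ-commutativeRing = record
  { Carrier = ℂ ; _≈_ = _≈ᶜ_ ; _+_ = _+ᶜ_ ; _*_ = _*ᶜ_ ; -_ = -ᶜ_ ; 0# = 0ᶜ ; 1# = 1ᶜ
  ; isCommutativeRing = record
    { isRing = record
      { +-isAbelianGroup = record
        { isGroup = record
          { isMonoid = record
            { isSemigroup = record
              { isMagma = record
                { isEquivalence = record
                  { refl  = reflᴿ , reflᴿ
                  ; sym   = λ p → symᴿ (re-≈ p) , symᴿ (im-≈ p)
                  ; trans = trans
                  }
                ; ∙-cong = cong⁺
                }
              ; assoc = assoc⁺
              }
            ; identity = identity⁺ , λ z → trans (comm⁺ z 0ᶜ) (identity⁺ z)
            }
          ; inverse = inverse⁺ , λ z → trans (comm⁺ z (-ᶜ z)) (inverse⁺ z)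
          ; ⁻¹-cong = λ p → neg-congᴿ (re-≈ p) , neg-congᴿ (im-≈ p)
          }
        ; comm = comm⁺
        }
      ; *-cong     = cong*
      ; *-assoc    = assoc*
      ; *-identity = identity* , λ z → trans (comm* z 1ᶜ) (identity* z)
      ; distrib    = distrib , λ z w v → trans (comm* (w +ᶜ v) z)
                       (trans (distrib z w v) (cong⁺ (comm* z w) (comm* z v)))
      }
    ; *-comm = comm*
    }
  }
  where open Laws

-- A unit carries its inverse, which is determined by the unit and so
-- plays no role in the equality.
module _ {c ℓ} (M : CommutativeMonoid c ℓ) where
  open CommutativeMonoid M
  open CommutativeSemigroupProperties commutativeSemigroup using (interchange)

  private
    Unit : Set (c ⊔ ℓ)
    Unit = Σ Carrier (Invertible _≈_ ε _∙_)

    _∘_ : Unit → Unit → Unit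
    (x , x⁻¹ , l , r) ∘ (y , y⁻¹ , l′ , r′) = x ∙ y , x⁻¹ ∙ y⁻¹
      , trans (interchange x⁻¹ y⁻¹ x y) (trans (∙-cong l l′) (identityˡ ε))
      , trans (interchange x y x⁻¹ y⁻¹) (trans (∙-cong r r′) (identityˡ ε))

    inv : Unit → Unit
    inv (x , x⁻¹ , l , r) = x⁻¹ , x , r , l

    inv-cong : ∀ {u v} → proj₁ u ≈ proj₁ v → proj₁ (inv u) ≈ proj₁ (inv v)
    inv-cong {x , x⁻¹ , l , r} {y , y⁻¹ , l′ , r′} x≈y =
      trans (sym (identityʳ x⁻¹)) (trans (∙-congˡ (sym r′))
        (trans (sym (assoc x⁻¹ y y⁻¹)) (trans (∙-congʳ (trans (∙-congˡ (sym x≈y)) l))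
          (identityˡ y⁻¹))))

  unitGroup : AbelianGroup (c ⊔ ℓ) ℓ
  unitGroup = record
    { Carrier = Unit
    ; _≈_     = λ u v → proj₁ u ≈ proj₁ v
    ; _∙_     = _∘_
    ; ε       = ε , ε , identityˡ ε , identityˡ ε
    ; _⁻¹     = inv
    ; isAbelianGroup = record
      { isGroup = record
        { isMonoid = record
          { isSemigroup = record
            { isMagma = record
              { isEquivalence = record { refl = refl ; sym = sym ; trans = trans }
              ; ∙-cong = ∙-cong
              }
            ; assoc = λ u v w → assoc (proj₁ u) (proj₁ v) (proj₁ w)
            }
          ; identity = (λ u → identityˡ (proj₁ u)) , (λ u → identityʳ (proj₁ u))
          }
        ; inverse = (λ (_ , _ , l , _) → l) , (λ (_ , _ , _ , r) → r)
        ; ⁻¹-cong = λ {u} {v} → inv-cong {u} {v}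
        }
      ; comm = λ u v → comm (proj₁ u) (proj₁ v)
      }
    }

ℂˣ : AbelianGroup 0ℓ 0ℓ
ℂˣ = unitGroup (CommutativeRing.*-commutativeMonoid ℂ-commutativeRing)

module Homomorphisms {g ℓg h ℓh} (G : Group g ℓg) (H : AbelianGroup h ℓh) where
  private
    module G = Group G
    module H = AbelianGroup H

  open AbelianGroupProperties H using (⁻¹-∙-comm)
  open CommutativeSemigroupProperties H.commutativeSemigroup using (interchange)
  open GroupHomomorphism
  open H using (_≈_; _∙_)

  Hom : Set (g ⊔ ℓg ⊔ h ⊔ ℓh)
  Hom = GroupHomomorphism G.rawGroup H.rawGroup

  private
    hom : (f : G.Carrier → H.Carrier) →
          (∀ {u v} → u G.≈ v → f u ≈ f v) →
          (∀ u v → f (u G.∙ v) ≈ f u ∙ f v) →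
          f G.ε ≈ H.ε →
          (∀ u → f (u G.⁻¹) ≈ f u H.⁻¹) → Hom
    hom f f-cong f-homo f-ε f-⁻¹ = record
      { ⟦_⟧ = f
      ; isGroupHomomorphism = record
        { isMonoidHomomorphism = record
          { isMagmaHomomorphism = record
            { isRelHomomorphism = record { cong = f-cong }
            ; homo = f-homo
            }
          ; ε-homo = f-ε
          }
        ; ⁻¹-homo = f-⁻¹
        }
      }

  trivial : Hom
  trivial = hom (λ _ → H.ε) (λ _ → H.refl) (λ _ _ → H.sym (H.identityˡ H.ε)) H.refl
    (λ _ → H.trans (H.sym (H.inverseʳ H.ε)) (H.identityˡ _))

  infixl 7 _·_
  _·_ : Hom → Hom → Hom
  χ · ψ = hom (λ u → ⟦ χ ⟧ u ∙ ⟦ ψ ⟧ u)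
    (λ u≈v → H.∙-cong (⟦⟧-cong χ u≈v) (⟦⟧-cong ψ u≈v))
    (λ u v → H.trans (H.∙-cong (homo χ u v) (homo ψ u v)) (interchange _ _ _ _))
    (H.trans (H.∙-cong (ε-homo χ) (ε-homo ψ)) (H.identityˡ H.ε))
    (λ u → H.trans (H.∙-cong (⁻¹-homo χ u) (⁻¹-homo ψ u)) (⁻¹-∙-comm _ _))

  infix 9 _⁻¹
  _⁻¹ : Hom → Hom
  χ ⁻¹ = hom (λ u → ⟦ χ ⟧ u H.⁻¹)
    (λ u≈v → H.⁻¹-cong (⟦⟧-cong χ u≈v))
    (λ u v → H.trans (H.⁻¹-cong (homo χ u v)) (H.sym (⁻¹-∙-comm _ _)))
    (H.trans (H.⁻¹-cong (ε-homo χ)) (H.trans (H.sym (H.identityˡ _)) (H.inverseʳ H.ε)))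
    (λ u → H.⁻¹-cong (⁻¹-homo χ u))

-- Such a field is unique up to isomorphism, so a statement about 𝔽_q is
-- a statement about every FiniteField with q elements.
record FiniteField (c ℓ : Level) (q : ℕ) : Set (lsuc (c ⊔ ℓ)) where
  field
    commutativeRing : CommutativeRing c ℓ

  open CommutativeRing commutativeRing public

  field
    0≉1         : ¬ 0# ≈ 1#
    invertible  : ∀ x → ¬ x ≈ 0# → Invertible _≈_ 1# _*_ x
    enumeration : Inverse setoid (≡.setoid (Fin q))

  infix 4 _≟_
  _≟_ : Decidable _≈_
  _≟_ = via-injection (Inverse⇒Injection enumeration) Fin._≟_

  element : Fin q → Carrier
  element = Inverse.from enumeration

  recip : ∀ x → ¬ x ≈ 0# → Carrier
  recip x x≉0 = proj₁ (invertible x x≉0)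

  unitsOfField : AbelianGroup (c ⊔ ℓ) ℓ
  unitsOfField = unitGroup *-commutativeMonoid

  q≢0 : ℕ.NonZero q
  q≢0 = Fin.nonZeroIndex (Inverse.to enumeration 0#)

module Lauricella {c ℓ : Level} {q : ℕ} (F : FiniteField c ℓ q) where

  open FiniteField F
    using (Carrier; _≈_; _+_; _*_; _-_; -_; 0#; 1#; +-commutativeMonoid;
           _≟_; invertible; element; unitsOfField; q≢0)
  private
    module Fˣ = AbelianGroup unitsOfField
    module ℂˣ = AbelianGroup ℂˣ
    module ℂ-ring = CommutativeRing ℂ-commutativeRing

  open Homomorphisms Fˣ.group ℂˣ public
    using (_·_; _⁻¹) renaming (Hom to Character; trivial to ε)
  open GroupHomomorphism using (⟦_⟧)

  infix 9 _⟨_⟩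
  _⟨_⟩ : Character → Carrier → ℂ
  χ ⟨ x ⟩ with x ≟ 0#
  ... | yes _   = 0ᶜ
  ... | no x≉0 = proj₁ (⟦ χ ⟧ (x , invertible x x≉0))

  infixl 7 _/q
  _/q : ℂ → ℂ
  z /q = z *ᶜ ratᶜ ((+ 1 ℚ./ q) {{q≢0}})

  ∑F : (Carrier → ℂ) → ℂ
  ∑F f = sum (λ i → f (element i))
    where open CommutativeMonoidSum ℂ-ring.+-commutativeMonoid using (sum)

  ∑Fᵐ : ∀ m → (Vector Carrier m → ℂ) → ℂ
  ∑Fᵐ zero    f = f []
  ∑Fᵐ (suc m) f = ∑F λ t → ∑Fᵐ m λ ts → f (t ∷ ts)

  open CommutativeMonoidSum ℂ-ring.*-commutativeMonoid using () renaming (sum to ∏)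
  open CommutativeMonoidSum +-commutativeMonoid using () renaming (sum to ∑)

  F-A : ∀ m → Character → (B C : Vector Character m) → Vector Carrier m → ℂ
  F-A m A B C x = ∑Fᵐ m λ t →
    ∏ (λ i → ε ⟨ x i ⟩ *ᶜ ((B i · C i) ⟨ - 1# ⟩ /q)
             *ᶜ B i ⟨ t i ⟩ *ᶜ (B i ⁻¹ · C i) ⟨ 1# - t i ⟩)
    *ᶜ (A ⁻¹) ⟨ 1# - ∑ (λ i → x i * t i) ⟩

-- If x_k = 0 both sides vanish, the left one through ε(x_k) and the right one through
-- C̄_k(x_k).  Otherwise substitute s = 1/(1 - x_k t_k) for t_k in the sum defining F_A,
-- where 1/0 is read as 0 so that the substitution is a bijection of 𝔽_q.  The term s = 0,
-- that is t_k = 1/x_k, leaves Ā(-∑_{i≠k} x_i t_i) and becomes the first summand after the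
-- reflection t_l ↦ 1 - t_l; for s ≠ 0 the argument of Ā is s⁻¹(1 - ∑_{i≠k} x_i s t_i), so A(s)
-- splits off and the remaining sum over the t_i is F_A at the arguments x_i s.
module Submission where

open import Defs
open import Algebra.Bundles using (AbelianGroup; CommutativeRing)
open import Algebra.Morphism.Bundles using (GroupHomomorphism)
import Algebra.Properties.CommutativeMonoid.Sum as CommutativeMonoidSum
import Algebra.Properties.CommutativeSemigroup as CommutativeSemigroupProperties
import Algebra.Properties.Ring as RingProperties
import Algebra.Properties.Semiring.Sum as SemiringSum
import Algebra.Solver.CommutativeMonoid as CommutativeMonoidSolver
open import Data.Fin.Base as Fin using (Fin; punchIn; punchOut)
import Data.Fin.Properties as Fin
open import Data.Integer.Base using (+_)
open import Data.Nat.Base as ℕ using (ℕ; suc; s≤s)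
open import Data.Nat.Divisibility using (_∣_)
open import Data.Nat.Primality using (Prime)
open import Data.Product.Base using (_,_; proj₁; proj₂)
import Data.Rational.Base as ℚ
open import Data.Vec.Functional using (Vector; []; _∷_; tail; insertAt; removeAt; updateAt)
open import Data.Vec.Functional.Properties using (insertAt-lookup; insertAt-punchIn; updateAt-updates; updateAt-minimal)
open import Function.Base using (_∘_)
open import Function.Bundles using (Inverse)
import Function.Construct.Composition as Composition
import Function.Construct.Symmetry as Symmetry
open import Level using (Level; _⊔_)
import Relation.Binary.Reasoning.Setoid as SetoidReasoning
open import Relation.Binary.PropositionalEquality as ≡ using (_≡_; _≢_)
open import Relation.Nullary using (¬_; Dec; yes; no; contradiction)

-- Fixing one coordinate replaces the constant 1 inside the last factor by `1# - x k * t`, so the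
-- argument is run on `Φ`, the series with an arbitrary constant z in that place. The substitution
-- makes z the inverse of s. A nonzero z can be scaled back to 1, but z = 0 cannot; this is why a
-- second index l with nonzero x_l is required: reflecting t_l produces a fresh constant. The k-th
-- factor B_k(t) B̄_kC_k(1 - t) is homogeneous: multiplying t and 1 - t by a common nonzero w is
-- paid for by C̄_k(w). Taking w = x_k s clears the denominators of t = (s - 1)/(x_k s) and of 1 -
-- t, and w = x_k does so at s = 0. This single rule yields C̄_k(x_k) in both summands, the C̄_k(s)
-- that joins A(s), and the arguments x_k - 1, s - 1 and 1 - s + x_k s. The sign C_l(-1) compares
-- the normalising constants before and after the reflection, B_lC_l(-1) and B_l′C_l(-1).

module ℂ-ring = CommutativeRing ℂ-commutativeRing
open ℂ-ring using () renaming
  ( refl to reflᶜ; sym to symᶜ; trans to transᶜ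
  ; +-cong to +ᶜ-cong; *-cong to *ᶜ-cong; *-congˡ to *ᶜ-congˡ; *-congʳ to *ᶜ-congʳ )
open SemiringSum ℂ-ring.semiring using (sum; sum-cong-≋; sum-remove; ∑-comm; sum-permute; sum-replicate-zero; *-distribˡ-sum)
module ∏ᶜ = CommutativeMonoidSum ℂ-ring.*-commutativeMonoid
open CommutativeMonoidSolver ℂ-ring.*-commutativeMonoid using (solve; _⊕_; _⊜_)

-- Splitting one term off a finite complex sum.

sum-extract : ∀ {n} (i : Fin n) (f h : Vector ℂ n) → h i ≈ᶜ 0ᶜ →
              (∀ j → j ≢ i → f j ≈ᶜ h j) → sum f ≈ᶜ f i +ᶜ sum h
sum-extract {suc n} i f h hi≈0 f≈h = begin
  sum f                             ≈⟨ sum-remove {i = i} f ⟩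
  f i +ᶜ sum (removeAt f i)         ≈⟨ ℂ-ring.+-congˡ (sum-cong-≋ (λ j → f≈h (punchIn i j) (Fin.punchInᵢ≢i i j))) ⟩
  f i +ᶜ sum (removeAt h i)         ≈⟨ ℂ-ring.+-congˡ (ℂ-ring.+-identityˡ _) ⟨
  f i +ᶜ (0ᶜ +ᶜ sum (removeAt h i)) ≈⟨ ℂ-ring.+-congˡ (ℂ-ring.+-congʳ hi≈0) ⟨
  f i +ᶜ (h i +ᶜ sum (removeAt h i)) ≈⟨ ℂ-ring.+-congˡ (sum-remove {i = i} h) ⟨
  f i +ᶜ sum h                      ∎
  where open SetoidReasoning ℂ-ring.setoid

-- Arithmetic and permutations of a finite field.

module _ {c ℓ : Level} {q : ℕ} (F : FiniteField c ℓ q) where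

  open FiniteField F
  open Lauricella F using (∑F; ∑Fᵐ)
  open RingProperties ring

  1-‿cong : ∀ {x y} → x ≈ y → 1# - x ≈ 1# - y
  1-‿cong x≈y = +-congˡ (-‿cong x≈y)

  1-[1-x]≈x : ∀ x → 1# - (1# - x) ≈ x
  1-[1-x]≈x x = begin
    1# - (1# - x)    ≈⟨ +-congˡ (⁻¹-anti-homo‿- 1# x) ⟩
    1# + (x - 1#)    ≈⟨ +-assoc 1# x (- 1#) ⟨
    1# + x - 1#      ≈⟨ xyx⁻¹≈y 1# x ⟩
    x                ∎
    where open SetoidReasoning setoid

  inverse≉0 : ∀ {x y} → x * y ≈ 1# → ¬ x ≈ 0#
  inverse≉0 xy≈1 x≈0 = 0≉1 (trans (sym (zeroˡ _)) (trans (*-congʳ (sym x≈0)) xy≈1))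

  recipˡ : ∀ {x} (x≉0 : ¬ x ≈ 0#) → recip x x≉0 * x ≈ 1#
  recipˡ {x} x≉0 = proj₁ (proj₂ (invertible x x≉0))

  recipʳ : ∀ {x} (x≉0 : ¬ x ≈ 0#) → x * recip x x≉0 ≈ 1#
  recipʳ {x} x≉0 = proj₂ (proj₂ (invertible x x≉0))

  *-≉0 : ∀ {x y} → ¬ x ≈ 0# → ¬ y ≈ 0# → ¬ x * y ≈ 0#
  *-≉0 {x} {y} x≉0 y≉0 xy≈0 = y≉0 (begin
    y                        ≈⟨ *-identityˡ y ⟨
    1# * y                   ≈⟨ *-congʳ (recipˡ x≉0) ⟨
    recip x x≉0 * x * y      ≈⟨ *-assoc _ x y ⟩
    recip x x≉0 * (x * y)    ≈⟨ *-congˡ xy≈0 ⟩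
    recip x x≉0 * 0#         ≈⟨ zeroʳ _ ⟩
    0#                       ∎)
    where open SetoidReasoning setoid

  -≉0 : ∀ {x} → ¬ x ≈ 0# → ¬ - x ≈ 0#
  -≉0 x≉0 -x≈0 = x≉0 (-‿injective (trans -x≈0 (sym -0#≈0#)))

  inv : Carrier → Carrier
  inv x with x ≟ 0#
  ... | yes _  = 0#
  ... | no x≉0 = recip x x≉0

  inv-zero : ∀ {x} → x ≈ 0# → inv x ≈ 0#
  inv-zero {x} x≈0 with x ≟ 0#
  ... | yes _  = refl
  ... | no x≉0 = contradiction x≈0 x≉0

  *-inv : ∀ {x} → ¬ x ≈ 0# → x * inv x ≈ 1#
  *-inv {x} x≉0 with x ≟ 0#
  ... | yes x≈0 = contradiction x≈0 x≉0
  ... | no x≉0′ = recipʳ x≉0′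

  inverse-unique : ∀ {x y z} → x * y ≈ 1# → x * z ≈ 1# → y ≈ z
  inverse-unique {x} {y} {z} xy≈1 xz≈1 = begin
    y              ≈⟨ *-identityʳ y ⟨
    y * 1#         ≈⟨ *-congˡ xz≈1 ⟨
    y * (x * z)    ≈⟨ *-assoc y x z ⟨
    y * x * z      ≈⟨ *-congʳ (trans (*-comm y x) xy≈1) ⟩
    1# * z         ≈⟨ *-identityˡ z ⟩
    z              ∎
    where open SetoidReasoning setoid

  -- `invertible` is not assumed to respect `≈`; that its choices agree on equal elements comes from
  -- the uniqueness of inverses.
  inv-cong : ∀ {x y} → x ≈ y → inv x ≈ inv y
  inv-cong {x} {y} x≈y = by-cases (x ≟ 0#)
    where
    by-cases : Dec (x ≈ 0#) → inv x ≈ inv y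
    by-cases (yes x≈0) = trans (inv-zero x≈0) (sym (inv-zero (trans (sym x≈y) x≈0)))
    by-cases (no x≉0)  = inverse-unique (*-inv x≉0)
      (trans (*-congʳ x≈y) (*-inv (λ y≈0 → x≉0 (trans x≈y y≈0))))

  inv-involutive : ∀ x → inv (inv x) ≈ x
  inv-involutive x = by-cases (x ≟ 0#)
    where
    by-cases : Dec (x ≈ 0#) → inv (inv x) ≈ x
    by-cases (yes x≈0) = trans (inv-zero (inv-zero x≈0)) (sym x≈0)
    by-cases (no x≉0)  = inverse-unique (*-inv (inverse≉0 inv*x)) inv*x
      where
      inv*x : inv x * x ≈ 1#
      inv*x = trans (*-comm _ x) (*-inv x≉0)

  Permutationᶠ : Set (c ⊔ ℓ)
  Permutationᶠ = Inverse setoid setoid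

  permutationᶠ : (f g : Carrier → Carrier) →
                 (∀ {x y} → x ≈ y → f x ≈ f y) → (∀ {x y} → x ≈ y → g x ≈ g y) →
                 (∀ x → f (g x) ≈ x) → (∀ x → g (f x) ≈ x) → Permutationᶠ
  permutationᶠ f g f-cong g-cong f∘g g∘f = record
    { to        = f
    ; from      = g
    ; to-cong   = f-cong
    ; from-cong = g-cong
    ; inverse   = (λ y≈gx → trans (f-cong y≈gx) (f∘g _))
                , (λ y≈fx → trans (g-cong y≈fx) (g∘f _))
    }

  reflection : Permutationᶠ
  reflection = permutationᶠ (λ x → 1# - x) (λ x → 1# - x) 1-‿cong 1-‿cong 1-[1-x]≈x 1-[1-x]≈x

  inversion : Permutationᶠ
  inversion = permutationᶠ inv inv inv-cong inv-cong inv-involutive inv-involutive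

  dilation : ∀ {x y} → x * y ≈ 1# → Permutationᶠ
  dilation {x} {y} xy≈1 = permutationᶠ (x *_) (y *_) *-congˡ *-congˡ
    (cancel xy≈1) (cancel (trans (*-comm y x) xy≈1))
    where
    cancel : ∀ {u v} → u * v ≈ 1# → ∀ z → u * (v * z) ≈ z
    cancel {u} {v} uv≈1 z = trans (sym (*-assoc u v z)) (trans (*-congʳ uv≈1) (*-identityˡ z))

  -- Sums over the field and over tuples of its elements.

  ∑F-cong : {f g : Carrier → ℂ} → (∀ t → f t ≈ᶜ g t) → ∑F f ≈ᶜ ∑F g
  ∑F-cong f≈g = sum-cong-≋ (λ i → f≈g (element i))

  *-distribˡ-∑F : ∀ z f → z *ᶜ ∑F f ≈ᶜ ∑F (λ t → z *ᶜ f t)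
  *-distribˡ-∑F z f = *-distribˡ-sum z (f ∘ element)

  ∑F-zero : ∑F (λ _ → 0ᶜ) ≈ᶜ 0ᶜ
  ∑F-zero = sum-replicate-zero q

  -- Conjugating π by the enumeration gives a permutation of `Fin q`. Passing through an index and
  -- back returns an element only up to `≈`, hence the congruence hypothesis on f.
  ∑F-permute : ∀ f → (∀ {s t} → s ≈ t → f s ≈ᶜ f t) → (π : Permutationᶠ) →
               ∑F f ≈ᶜ ∑F (f ∘ Inverse.to π)
  ∑F-permute f f-cong π = transᶜ
    (sum-permute (f ∘ element)
      (Composition.inverse (Symmetry.inverse enumeration) (Composition.inverse π enumeration)))
    (sum-cong-≋ {q} (λ i → f-cong (Inverse.strictlyInverseʳ enumeration (Inverse.to π (element i)))))

  ∑Fᵐ-cong : ∀ m {f g} → (∀ t → f t ≈ᶜ g t) → ∑Fᵐ m f ≈ᶜ ∑Fᵐ m g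
  ∑Fᵐ-cong ℕ.zero  f≈g = f≈g []
  ∑Fᵐ-cong (suc m) {f} {g} f≈g = ∑F-cong (λ t → ∑Fᵐ-cong m {f ∘ (t ∷_)} {g ∘ (t ∷_)} (λ ts → f≈g (t ∷ ts)))

  *-distribˡ-∑Fᵐ : ∀ m z f → z *ᶜ ∑Fᵐ m f ≈ᶜ ∑Fᵐ m (λ t → z *ᶜ f t)
  *-distribˡ-∑Fᵐ ℕ.zero  z f = reflᶜ
  *-distribˡ-∑Fᵐ (suc m) z f = transᶜ (*-distribˡ-∑F z (λ t → ∑Fᵐ m (λ ts → f (t ∷ ts))))
    (∑F-cong (λ t → *-distribˡ-∑Fᵐ m z (λ ts → f (t ∷ ts))))

  ∑F-comm : (f : Carrier → Carrier → ℂ) → ∑F (λ s → ∑F (f s)) ≈ᶜ ∑F (λ t → ∑F (λ s → f s t))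
  ∑F-comm f = ∑-comm {q} {q} (λ i j → f (element i) (element j))

  -- Since h vanishes at 0, the remaining terms again form a sum over the whole field, the shape of
  -- the second summand of the formula.
  ∑F-extract-zero : ∀ f h → (∀ {s t} → s ≈ t → f s ≈ᶜ f t) → (∀ {s} → s ≈ 0# → h s ≈ᶜ 0ᶜ) →
                    (∀ {s} → ¬ s ≈ 0# → f s ≈ᶜ h s) → ∑F f ≈ᶜ f 0# +ᶜ ∑F h
  ∑F-extract-zero f h f-cong h-zero f≈h = transᶜ
    (sum-extract i₀ (f ∘ element) (h ∘ element) (h-zero i₀↦0) λ j j≢i₀ → f≈h λ ej≈0 →
      j≢i₀ (≡.trans (≡.sym (Inverse.strictlyInverseˡ enumeration j)) (Inverse.to-cong enumeration ej≈0)))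
    (ℂ-ring.+-congʳ (f-cong i₀↦0))
    where
    i₀ : Fin q
    i₀ = Inverse.to enumeration 0#
    i₀↦0 : element i₀ ≈ 0#
    i₀↦0 = Inverse.strictlyInverseʳ enumeration 0#

  -- Vectors are functions, and differently built tuples such as `s ∷ insertAt ts k t` and
  -- `insertAt (s ∷ ts) (suc k) t` agree only entry by entry. Rearranging coordinates therefore
  -- requires summands that respect entrywise equality.
  Extensional : ∀ {m} → (Vector Carrier m → ℂ) → Set (c ⊔ ℓ)
  Extensional {m} f = (s t : Vector Carrier m) → (∀ i → s i ≈ t i) → f s ≈ᶜ f t

  ∷-cong : ∀ {m s t} {ss ts : Vector Carrier m} → s ≈ t → (∀ i → ss i ≈ ts i) → ∀ i → (s ∷ ss) i ≈ (t ∷ ts) i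
  ∷-cong s≈t ss≈ts Fin.zero    = s≈t
  ∷-cong s≈t ss≈ts (Fin.suc i) = ss≈ts i

  Extensional-∷ : ∀ {m f} → Extensional {suc m} f → ∀ t → Extensional {m} (λ ts → f (t ∷ ts))
  Extensional-∷ f-ext t ss ts ss≈ts = f-ext (t ∷ ss) (t ∷ ts) (∷-cong refl ss≈ts)

  -- `∑Fᵐ` nests with coordinate 0 outermost. Coordinate k is brought to the outside by exchanging
  -- it with one earlier coordinate per induction step.
  ∑Fᵐ-insertAt : ∀ {m} k f → Extensional f →
                 ∑Fᵐ (suc m) f ≈ᶜ ∑F (λ t → ∑Fᵐ m (λ ts → f (insertAt ts k t)))
  ∑Fᵐ-insertAt {m} Fin.zero f f-ext = ∑F-cong λ t → ∑Fᵐ-cong m λ ts →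
    f-ext (t ∷ ts) (insertAt ts Fin.zero t) λ { Fin.zero → refl ; (Fin.suc _) → refl }
  ∑Fᵐ-insertAt {suc m} (Fin.suc k) f f-ext = begin
    ∑F (λ s → ∑Fᵐ (suc m) (λ ts → f (s ∷ ts)))
      ≈⟨ ∑F-cong (λ s → ∑Fᵐ-insertAt k (λ ts → f (s ∷ ts)) (Extensional-∷ f-ext s)) ⟩
    ∑F (λ s → ∑F (λ t → ∑Fᵐ m (λ ts → f (s ∷ insertAt ts k t))))
      ≈⟨ ∑F-comm (λ s t → ∑Fᵐ m (λ ts → f (s ∷ insertAt ts k t))) ⟩
    ∑F (λ t → ∑F (λ s → ∑Fᵐ m (λ ts → f (s ∷ insertAt ts k t))))
      ≈⟨ ∑F-cong (λ t → ∑F-cong λ s → ∑Fᵐ-cong m λ ts →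
           f-ext (s ∷ insertAt ts k t) (insertAt (s ∷ ts) (Fin.suc k) t) λ { Fin.zero → refl ; (Fin.suc _) → refl }) ⟩
    ∑F (λ t → ∑Fᵐ (suc m) (λ ts → f (insertAt ts (Fin.suc k) t)))
      ∎
    where open SetoidReasoning ℂ-ring.setoid

  ∑Fᵐ-permuteAt : ∀ {m} l f → Extensional f → (π : Permutationᶠ) →
                  ∑Fᵐ m f ≈ᶜ ∑Fᵐ m (λ t → f (updateAt t l (Inverse.to π)))
  ∑Fᵐ-permuteAt {suc m} Fin.zero f f-ext π = transᶜ
    (∑F-permute (λ t → ∑Fᵐ m (λ ts → f (t ∷ ts)))
      (λ {s} {t} s≈t → ∑Fᵐ-cong m λ ts → f-ext (s ∷ ts) (t ∷ ts) (∷-cong s≈t (λ _ → refl))) π)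
    (∑F-cong λ t → ∑Fᵐ-cong m λ ts →
      f-ext (Inverse.to π t ∷ ts) (updateAt (t ∷ ts) Fin.zero (Inverse.to π)) λ { Fin.zero → refl ; (Fin.suc _) → refl })
  ∑Fᵐ-permuteAt {suc m} (Fin.suc l) f f-ext π = ∑F-cong λ t → transᶜ
    (∑Fᵐ-permuteAt l (λ ts → f (t ∷ ts)) (Extensional-∷ f-ext t) π)
    (∑Fᵐ-cong m λ ts →
      f-ext (t ∷ updateAt ts l (Inverse.to π)) (updateAt (t ∷ ts) (Fin.suc l) (Inverse.to π)) λ { Fin.zero → refl ; (Fin.suc _) → refl })


-- Characters as functions on the whole field.

module _ {c ℓ : Level} {q : ℕ} (F : FiniteField c ℓ q) where

  open FiniteField F

  -- The properties of characters used below.  Abstracting over the characters also keeps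
  -- the type checker from unfolding the homomorphism proofs that they carry.
  record IsCharacterGroup {a : Level} (X : Set a) (_·_ : X → X → X) (_⁻¹ : X → X) (ε : X)
                          (_⟨_⟩ : X → Carrier → ℂ) : Set (a ⊔ c ⊔ ℓ) where
    field
      ⟨⟩-cong : ∀ χ {x y} → x ≈ y → (χ ⟨ x ⟩) ≈ᶜ (χ ⟨ y ⟩)
      ⟨⟩-zero : ∀ χ {x} → x ≈ 0# → (χ ⟨ x ⟩) ≈ᶜ 0ᶜ
      ⟨1⟩     : ∀ χ {x} → x ≈ 1# → (χ ⟨ x ⟩) ≈ᶜ 1ᶜ
      ⟨⟩-*    : ∀ χ x y → (χ ⟨ x * y ⟩) ≈ᶜ (χ ⟨ x ⟩) *ᶜ (χ ⟨ y ⟩)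
      ·-⟨⟩    : ∀ χ ψ x → ((χ · ψ) ⟨ x ⟩) ≈ᶜ (χ ⟨ x ⟩) *ᶜ (ψ ⟨ x ⟩)
      ⁻¹-⟨⟩   : ∀ χ {x} → ¬ x ≈ 0# → (χ ⟨ x ⟩) *ᶜ ((χ ⁻¹) ⟨ x ⟩) ≈ᶜ 1ᶜ
      ε-⟨⟩    : ∀ {x} → ¬ x ≈ 0# → (ε ⟨ x ⟩) ≈ᶜ 1ᶜ

module MultiplicativeCharacters {c ℓ : Level} {q : ℕ} (F : FiniteField c ℓ q) where

  open FiniteField F
  open Lauricella F
  open GroupHomomorphism using (⟦_⟧; ⟦⟧-cong; homo; ε-homo)

  private
    module Fˣ = AbelianGroup unitsOfField

  -- `_⟨_⟩` uses the proof of nonvanishing found by `_≟_`. Any other proof may replace it, because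
  -- units are compared by their underlying elements and χ respects that equality.
  ⟨⟩-unit : ∀ χ {x} (x≉0 : ¬ x ≈ 0#) → χ ⟨ x ⟩ ≈ᶜ proj₁ (⟦ χ ⟧ (x , invertible x x≉0))
  ⟨⟩-unit χ {x} x≉0 with x ≟ 0#
  ... | yes x≈0 = contradiction x≈0 x≉0
  ... | no x≉0′ = ⟦⟧-cong χ {x , invertible x x≉0′} {x , invertible x x≉0} refl

  ⟨⟩-zero : ∀ χ {x} → x ≈ 0# → χ ⟨ x ⟩ ≈ᶜ 0ᶜ
  ⟨⟩-zero χ {x} x≈0 with x ≟ 0#
  ... | yes _  = reflᶜ
  ... | no x≉0 = contradiction x≈0 x≉0

  ⟨⟩-cong : ∀ χ {x y} → x ≈ y → χ ⟨ x ⟩ ≈ᶜ χ ⟨ y ⟩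
  ⟨⟩-cong χ {x} {y} x≈y with x ≟ 0#
  ... | yes x≈0 = symᶜ (⟨⟩-zero χ (trans (sym x≈y) x≈0))
  ... | no x≉0  = transᶜ (⟦⟧-cong χ {x , invertible x x≉0} {y , invertible y y≉0} x≈y)
                    (symᶜ (⟨⟩-unit χ y≉0))
    where y≉0 = λ y≈0 → x≉0 (trans x≈y y≈0)

  ⟨⟩-* : ∀ χ x y → χ ⟨ x * y ⟩ ≈ᶜ χ ⟨ x ⟩ *ᶜ χ ⟨ y ⟩
  ⟨⟩-* χ x y = by-cases (x ≟ 0#) (y ≟ 0#)
    where
    by-cases : Dec (x ≈ 0#) → Dec (y ≈ 0#) → χ ⟨ x * y ⟩ ≈ᶜ χ ⟨ x ⟩ *ᶜ χ ⟨ y ⟩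
    by-cases (yes x≈0) _ = transᶜ (⟨⟩-zero χ (trans (*-congʳ x≈0) (zeroˡ y)))
      (symᶜ (transᶜ (*ᶜ-congʳ (⟨⟩-zero χ x≈0)) (ℂ-ring.zeroˡ _)))
    by-cases (no _) (yes y≈0) = transᶜ (⟨⟩-zero χ (trans (*-congˡ y≈0) (zeroʳ x)))
      (symᶜ (transᶜ (*ᶜ-congˡ (⟨⟩-zero χ y≈0)) (ℂ-ring.zeroʳ _)))
    by-cases (no x≉0) (no y≉0) = begin
      χ ⟨ x * y ⟩                     ≈⟨ ⟨⟩-unit χ xy≉0 ⟩
      proj₁ (⟦ χ ⟧ (x * y , invertible _ xy≉0))
        -- The chosen inverse of `x * y` and the product of the chosen inverses may be different
        -- terms, but the two units have the same first component.
        ≈⟨ ⟦⟧-cong χ {x * y , invertible _ xy≉0} {u Fˣ.∙ v} refl ⟩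
      proj₁ (⟦ χ ⟧ (u Fˣ.∙ v))        ≈⟨ homo χ u v ⟩
      proj₁ (⟦ χ ⟧ u) *ᶜ proj₁ (⟦ χ ⟧ v)    ≈⟨ *ᶜ-cong (⟨⟩-unit χ x≉0) (⟨⟩-unit χ y≉0) ⟨
      χ ⟨ x ⟩ *ᶜ χ ⟨ y ⟩              ∎
      where
      open SetoidReasoning ℂ-ring.setoid
      xy≉0 = *-≉0 F x≉0 y≉0
      u v : Fˣ.Carrier
      u = x , invertible x x≉0
      v = y , invertible y y≉0

  ⟨1⟩ : ∀ χ {x} → x ≈ 1# → χ ⟨ x ⟩ ≈ᶜ 1ᶜ
  ⟨1⟩ χ {x} x≈1 = transᶜ (⟨⟩-unit χ x≉0)
    (transᶜ (⟦⟧-cong χ {x , invertible x x≉0} {Fˣ.ε} x≈1) (ε-homo χ))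
    where x≉0 = λ x≈0 → 0≉1 (trans (sym x≈0) x≈1)

  ·-⟨⟩ : ∀ χ ψ x → (χ · ψ) ⟨ x ⟩ ≈ᶜ χ ⟨ x ⟩ *ᶜ ψ ⟨ x ⟩
  ·-⟨⟩ χ ψ x = by-cases (x ≟ 0#)
    where
    by-cases : Dec (x ≈ 0#) → (χ · ψ) ⟨ x ⟩ ≈ᶜ χ ⟨ x ⟩ *ᶜ ψ ⟨ x ⟩
    by-cases (yes x≈0) = transᶜ (⟨⟩-zero (χ · ψ) x≈0)
      (symᶜ (transᶜ (*ᶜ-congʳ (⟨⟩-zero χ x≈0)) (ℂ-ring.zeroˡ _)))
    by-cases (no x≉0)  = transᶜ (⟨⟩-unit (χ · ψ) x≉0)
      (symᶜ (*ᶜ-cong (⟨⟩-unit χ x≉0) (⟨⟩-unit ψ x≉0)))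

  ⁻¹-⟨⟩ : ∀ χ {x} → ¬ x ≈ 0# → χ ⟨ x ⟩ *ᶜ (χ ⁻¹) ⟨ x ⟩ ≈ᶜ 1ᶜ
  ⁻¹-⟨⟩ χ {x} x≉0 = transᶜ (*ᶜ-cong (⟨⟩-unit χ x≉0) (⟨⟩-unit (χ ⁻¹) x≉0))
    (proj₂ (proj₂ (proj₂ (⟦ χ ⟧ (x , invertible x x≉0)))))

  ε-⟨⟩ : ∀ {x} → ¬ x ≈ 0# → ε ⟨ x ⟩ ≈ᶜ 1ᶜ
  ε-⟨⟩ x≉0 = ⟨⟩-unit ε x≉0

  isCharacterGroup : IsCharacterGroup F Character _·_ _⁻¹ ε _⟨_⟩
  isCharacterGroup = record
    { ⟨⟩-cong = ⟨⟩-cong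
    ; ⟨⟩-zero = ⟨⟩-zero
    ; ⟨1⟩     = ⟨1⟩
    ; ⟨⟩-*    = ⟨⟩-*
    ; ·-⟨⟩    = ·-⟨⟩
    ; ⁻¹-⟨⟩   = ⁻¹-⟨⟩
    ; ε-⟨⟩    = ε-⟨⟩
    }

-- Transformation rules and the reduction formula, over abstract characters.

module Reduction {c ℓ : Level} {q : ℕ} (F : FiniteField c ℓ q) {a : Level} {X : Set a}
                 {_·_ : X → X → X} {_⁻¹ : X → X} {ε : X} {_⟨_⟩ : X → FiniteField.Carrier F → ℂ}
                 (isCharGroup : IsCharacterGroup F X _·_ _⁻¹ ε _⟨_⟩) where

  open FiniteField F
  open Lauricella F using (∑F; ∑Fᵐ; _/q)
  open IsCharacterGroup isCharGroup
  open RingProperties ring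
  open CommutativeMonoidSum +-commutativeMonoid using () renaming (sum to ∑; sum-remove to ∑-remove; sum-cong-≋ to ∑-cong)
  open SemiringSum semiring using () renaming (*-distribˡ-sum to *-distribˡ-∑)

  ε-absorbs-unit : ∀ x {u} → ¬ u ≈ 0# → ε ⟨ x * u ⟩ ≈ᶜ ε ⟨ x ⟩
  ε-absorbs-unit x {u} u≉0 = transᶜ (⟨⟩-* ε x u) (transᶜ (*ᶜ-congˡ (ε-⟨⟩ u≉0)) (ℂ-ring.*-identityʳ _))

  -- Multiplicativity gives χ̄(sv) = χ̄(s) χ̄(v), and χ(s) cancels χ̄(s). This is the source of A(s)
  -- in the formula.
  ⁻¹-⟨⟩-rescale : ∀ χ {s v w} → ¬ s ≈ 0# → s * v ≈ w → (χ ⁻¹) ⟨ v ⟩ ≈ᶜ χ ⟨ s ⟩ *ᶜ (χ ⁻¹) ⟨ w ⟩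
  ⁻¹-⟨⟩-rescale χ {s} {v} {w} s≉0 sv≈w = begin
    (χ ⁻¹) ⟨ v ⟩                                  ≈⟨ ℂ-ring.*-identityˡ _ ⟨
    1ᶜ *ᶜ (χ ⁻¹) ⟨ v ⟩                            ≈⟨ *ᶜ-congʳ (⁻¹-⟨⟩ χ s≉0) ⟨
    χ ⟨ s ⟩ *ᶜ (χ ⁻¹) ⟨ s ⟩ *ᶜ (χ ⁻¹) ⟨ v ⟩       ≈⟨ ℂ-ring.*-assoc _ _ _ ⟩
    χ ⟨ s ⟩ *ᶜ ((χ ⁻¹) ⟨ s ⟩ *ᶜ (χ ⁻¹) ⟨ v ⟩)     ≈⟨ *ᶜ-congˡ (⟨⟩-* (χ ⁻¹) s v) ⟨
    χ ⟨ s ⟩ *ᶜ (χ ⁻¹) ⟨ s * v ⟩                   ≈⟨ *ᶜ-congˡ (⟨⟩-cong (χ ⁻¹) sv≈w) ⟩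
    χ ⟨ s ⟩ *ᶜ (χ ⁻¹) ⟨ w ⟩                       ∎
    where open SetoidReasoning ℂ-ring.setoid

  ⟨-1⟩² : ∀ χ → χ ⟨ - 1# ⟩ *ᶜ χ ⟨ - 1# ⟩ ≈ᶜ 1ᶜ
  ⟨-1⟩² χ = transᶜ (symᶜ (⟨⟩-* χ (- 1#) (- 1#)))
    (⟨1⟩ χ (trans (-1*x≈-x (- 1#)) (-‿involutive 1#)))

  ⁻¹-⟨-1⟩ : ∀ χ → (χ ⁻¹) ⟨ - 1# ⟩ ≈ᶜ χ ⟨ - 1# ⟩
  ⁻¹-⟨-1⟩ χ = begin
    (χ ⁻¹) ⟨ - 1# ⟩                  ≈⟨ ⁻¹-⟨⟩-rescale χ (-≉0 F (0≉1 ∘ sym)) (trans (-1*x≈-x (- 1#)) (-‿involutive 1#)) ⟩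
    χ ⟨ - 1# ⟩ *ᶜ (χ ⁻¹) ⟨ 1# ⟩      ≈⟨ *ᶜ-congˡ (⟨1⟩ (χ ⁻¹) refl) ⟩
    χ ⟨ - 1# ⟩ *ᶜ 1ᶜ                 ≈⟨ ℂ-ring.*-identityʳ _ ⟩
    χ ⟨ - 1# ⟩                       ∎
    where open SetoidReasoning ℂ-ring.setoid

  -- Only the values of elements of `X` are governed by laws, so identities between characters take
  -- this form.
  _≐_ : X → X → Set c
  χ ≐ ψ = ∀ x → χ ⟨ x ⟩ ≈ᶜ ψ ⟨ x ⟩

  -- The map sending B to B̄C is an involution, as it must be to match a reflection. Cancelling C
  -- against C̄ is possible only away from 0, where both sides vanish instead.
  B′⁻¹C≐B : ∀ B C B′ → B′ ≐ ((B ⁻¹) · C) → ((B′ ⁻¹) · C) ≐ B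
  B′⁻¹C≐B B C B′ B′≐ t = by-cases (t ≟ 0#)
    where
    open SetoidReasoning ℂ-ring.setoid
    b b̄ γ δ δ̄ : ℂ
    b = B ⟨ t ⟩
    b̄ = (B ⁻¹) ⟨ t ⟩
    γ = C ⟨ t ⟩
    δ = B′ ⟨ t ⟩
    δ̄ = (B′ ⁻¹) ⟨ t ⟩
    by-cases : Dec (t ≈ 0#) → ((B′ ⁻¹) · C) ⟨ t ⟩ ≈ᶜ B ⟨ t ⟩
    by-cases (yes t≈0) = transᶜ (⟨⟩-zero ((B′ ⁻¹) · C) t≈0) (symᶜ (⟨⟩-zero B t≈0))
    by-cases (no t≉0)  = begin
      ((B′ ⁻¹) · C) ⟨ t ⟩            ≈⟨ ·-⟨⟩ (B′ ⁻¹) C t ⟩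
      δ̄ *ᶜ γ                       ≈⟨ ℂ-ring.*-identityˡ _ ⟨
      1ᶜ *ᶜ (δ̄ *ᶜ γ)               ≈⟨ *ᶜ-congʳ (⁻¹-⟨⟩ B t≉0) ⟨
      (b *ᶜ b̄) *ᶜ (δ̄ *ᶜ γ)         ≈⟨ solve 4 (λ b b̄ δ̄ γ → (b ⊕ b̄) ⊕ (δ̄ ⊕ γ) ⊜ ((b̄ ⊕ γ) ⊕ δ̄) ⊕ b) reflᶜ b b̄ δ̄ γ ⟩
      (b̄ *ᶜ γ) *ᶜ δ̄ *ᶜ b           ≈⟨ *ᶜ-congʳ (*ᶜ-congʳ (transᶜ (B′≐ t) (·-⟨⟩ (B ⁻¹) C t))) ⟨
      δ *ᶜ δ̄ *ᶜ b                  ≈⟨ *ᶜ-congʳ (⁻¹-⟨⟩ B′ t≉0) ⟩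
      1ᶜ *ᶜ b                      ≈⟨ ℂ-ring.*-identityˡ b ⟩
      b                            ∎

  -- The finite field analogue of the normalised Beta kernel t^(b-1) (1-t)^(c-b-1) of an Euler
  -- integral. It sees x only through ε(x), so multiplying x by a unit leaves it unchanged.
  weight : (B C : X) (x t : Carrier) → ℂ
  weight B C x t = ε ⟨ x ⟩ *ᶜ ((B · C) ⟨ - 1# ⟩ /q) *ᶜ B ⟨ t ⟩ *ᶜ ((B ⁻¹) · C) ⟨ 1# - t ⟩

  -- For z = 1# this is the summand of F-A.
  integrand : ∀ {m} → X → (B C : Vector X m) → Vector Carrier m → Carrier →
              Vector Carrier m → ℂ
  integrand A B C x z t =
    ∏ᶜ.sum (λ i → weight (B i) (C i) (x i) (t i)) *ᶜ (A ⁻¹) ⟨ z - ∑ (λ i → x i * t i) ⟩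

  -- The free constant z makes the family closed under fixing a coordinate: z becomes `z - x k * t`.
  Φ : ∀ m → X → (B C : Vector X m) → Vector Carrier m → Carrier → ℂ
  Φ m A B C x z = ∑Fᵐ m (integrand A B C x z)

  weight-cong : ∀ B C {x y s t} → ε ⟨ x ⟩ ≈ᶜ ε ⟨ y ⟩ → s ≈ t → weight B C x s ≈ᶜ weight B C y t
  weight-cong B C εx≈εy s≈t = *ᶜ-cong
    (*ᶜ-cong (*ᶜ-congʳ εx≈εy) (⟨⟩-cong B s≈t)) (⟨⟩-cong ((B ⁻¹) · C) (1-‿cong F s≈t))

  weight-zero : ∀ B C {x} t → x ≈ 0# → weight B C x t ≈ᶜ 0ᶜ
  weight-zero B C t x≈0 = begin
    weight B C _ t                                                 ≈⟨ *ᶜ-congʳ (*ᶜ-congʳ (*ᶜ-congʳ (⟨⟩-zero ε x≈0))) ⟩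
    0ᶜ *ᶜ ((B · C) ⟨ - 1# ⟩ /q) *ᶜ B ⟨ t ⟩ *ᶜ ((B ⁻¹) · C) ⟨ 1# - t ⟩ ≈⟨ *ᶜ-congʳ (*ᶜ-congʳ (ℂ-ring.zeroˡ _)) ⟩
    0ᶜ *ᶜ B ⟨ t ⟩ *ᶜ ((B ⁻¹) · C) ⟨ 1# - t ⟩                         ≈⟨ *ᶜ-congʳ (ℂ-ring.zeroˡ _) ⟩
    0ᶜ *ᶜ ((B ⁻¹) · C) ⟨ 1# - t ⟩                                    ≈⟨ ℂ-ring.zeroˡ _ ⟩
    0ᶜ                                                             ∎
    where open SetoidReasoning ℂ-ring.setoid

  -- Scaling t and 1 - t by w contributes B(w) B̄(w) C(w) = C(w), which C̄(w) cancels. A good choice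
  -- of w removes the denominators of t.
  weight-rescale : ∀ B C {x w} t → ¬ x ≈ 0# → ¬ w ≈ 0# → weight B C x t ≈ᶜ
    ((B · C) ⟨ - 1# ⟩ /q) *ᶜ ((C ⁻¹) ⟨ w ⟩ *ᶜ B ⟨ w * t ⟩ *ᶜ ((B ⁻¹) · C) ⟨ w * (1# - t) ⟩)
  weight-rescale B C {x} {w} t x≉0 w≉0 = begin
    ε ⟨ x ⟩ *ᶜ κ *ᶜ B ⟨ t ⟩ *ᶜ ((B ⁻¹) · C) ⟨ 1# - t ⟩
      ≈⟨ *ᶜ-cong (*ᶜ-congʳ (transᶜ (*ᶜ-congʳ (ε-⟨⟩ x≉0)) (ℂ-ring.*-identityˡ κ))) (·-⟨⟩ (B ⁻¹) C (1# - t)) ⟩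
    κ *ᶜ B ⟨ t ⟩ *ᶜ (B̄ *ᶜ C₁)
      ≈⟨ *ᶜ-congʳ (*ᶜ-congˡ (ℂ-ring.*-identityˡ _)) ⟨
    κ *ᶜ (1ᶜ *ᶜ B ⟨ t ⟩) *ᶜ (B̄ *ᶜ C₁)
      ≈⟨ *ᶜ-cong (*ᶜ-congˡ (*ᶜ-congʳ (⁻¹-⟨⟩ B w≉0))) (transᶜ (*ᶜ-congʳ (⁻¹-⟨⟩ C w≉0)) (ℂ-ring.*-identityˡ _)) ⟨
    κ *ᶜ (B ⟨ w ⟩ *ᶜ (B ⁻¹) ⟨ w ⟩ *ᶜ B ⟨ t ⟩) *ᶜ (C ⟨ w ⟩ *ᶜ (C ⁻¹) ⟨ w ⟩ *ᶜ (B̄ *ᶜ C₁))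
      ≈⟨ solve 8 (λ κ b b̄ b₁ c c̄ b̄₂ c₂ →
           (κ ⊕ ((b ⊕ b̄) ⊕ b₁)) ⊕ ((c ⊕ c̄) ⊕ (b̄₂ ⊕ c₂)) ⊜ κ ⊕ ((c̄ ⊕ (b ⊕ b₁)) ⊕ ((b̄ ⊕ b̄₂) ⊕ (c ⊕ c₂))))
           reflᶜ κ (B ⟨ w ⟩) ((B ⁻¹) ⟨ w ⟩) (B ⟨ t ⟩) (C ⟨ w ⟩) ((C ⁻¹) ⟨ w ⟩) B̄ C₁ ⟩
    κ *ᶜ ((C ⁻¹) ⟨ w ⟩ *ᶜ (B ⟨ w ⟩ *ᶜ B ⟨ t ⟩) *ᶜ (((B ⁻¹) ⟨ w ⟩ *ᶜ B̄) *ᶜ (C ⟨ w ⟩ *ᶜ C₁)))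
      ≈⟨ *ᶜ-congˡ (*ᶜ-cong (*ᶜ-congˡ (⟨⟩-* B w t)) (*ᶜ-cong (⟨⟩-* (B ⁻¹) w (1# - t)) (⟨⟩-* C w (1# - t)))) ⟨
    κ *ᶜ ((C ⁻¹) ⟨ w ⟩ *ᶜ B ⟨ w * t ⟩ *ᶜ ((B ⁻¹) ⟨ w * (1# - t) ⟩ *ᶜ C ⟨ w * (1# - t) ⟩))
      ≈⟨ *ᶜ-congˡ (*ᶜ-congˡ (·-⟨⟩ (B ⁻¹) C (w * (1# - t)))) ⟨
    κ *ᶜ ((C ⁻¹) ⟨ w ⟩ *ᶜ B ⟨ w * t ⟩ *ᶜ ((B ⁻¹) · C) ⟨ w * (1# - t) ⟩)
      ∎
    where
    open SetoidReasoning ℂ-ring.setoid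
    κ B̄ C₁ : ℂ
    κ = (B · C) ⟨ - 1# ⟩ /q
    B̄ = (B ⁻¹) ⟨ 1# - t ⟩
    C₁ = C ⟨ 1# - t ⟩

  -- The reflection exchanges the two factors, hence B and B̄C. The constants match because values
  -- at -1 square to 1: B′C(-1) = B̄(-1) C(-1)² = B(-1), so BC(-1) = C(-1) B′C(-1).
  weight-reflect : ∀ B C B′ {x y} t → B′ ≐ ((B ⁻¹) · C) → ¬ x ≈ 0# → ¬ y ≈ 0# →
                   weight B C x t ≈ᶜ C ⟨ - 1# ⟩ *ᶜ weight B′ C y (1# - t)
  weight-reflect B C B′ {x} {y} t B′≐ x≉0 y≉0 = begin
    ε ⟨ x ⟩ *ᶜ ((B · C) ⟨ - 1# ⟩ /q) *ᶜ b *ᶜ b̄c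
      ≈⟨ *ᶜ-cong (*ᶜ-congʳ (*ᶜ-cong (transᶜ (ε-⟨⟩ x≉0) (symᶜ (ε-⟨⟩ y≉0))) (*ᶜ-congʳ sign))) (symᶜ (B′≐ (1# - t))) ⟩
    ε ⟨ y ⟩ *ᶜ ((γ *ᶜ s) *ᶜ 1/q) *ᶜ b *ᶜ b′
      ≈⟨ solve 6 (λ e c s r b d → ((e ⊕ ((c ⊕ s) ⊕ r)) ⊕ b) ⊕ d ⊜ c ⊕ (((e ⊕ (s ⊕ r)) ⊕ d) ⊕ b)) reflᶜ (ε ⟨ y ⟩) γ s 1/q b b′ ⟩
    γ *ᶜ (ε ⟨ y ⟩ *ᶜ (s /q) *ᶜ b′ *ᶜ b)
      ≈⟨ *ᶜ-congˡ (*ᶜ-congˡ (transᶜ (B′⁻¹C≐B B C B′ B′≐ (1# - (1# - t))) (⟨⟩-cong B (1-[1-x]≈x F t)))) ⟨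
    γ *ᶜ weight B′ C y (1# - t)
      ∎
    where
    open SetoidReasoning ℂ-ring.setoid
    b b̄c b′ γ s 1/q : ℂ
    b = B ⟨ t ⟩
    b̄c = ((B ⁻¹) · C) ⟨ 1# - t ⟩
    b′ = B′ ⟨ 1# - t ⟩
    γ = C ⟨ - 1# ⟩
    s = (B′ · C) ⟨ - 1# ⟩
    1/q = ratᶜ ((+ 1 ℚ./ q) {{q≢0}})
    sign : (B · C) ⟨ - 1# ⟩ ≈ᶜ γ *ᶜ s
    sign = begin
      (B · C) ⟨ - 1# ⟩                             ≈⟨ ·-⟨⟩ B C (- 1#) ⟩
      B ⟨ - 1# ⟩ *ᶜ γ                              ≈⟨ *ᶜ-congʳ (⁻¹-⟨-1⟩ B) ⟨
      (B ⁻¹) ⟨ - 1# ⟩ *ᶜ γ                         ≈⟨ ℂ-ring.*-identityˡ _ ⟨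
      1ᶜ *ᶜ ((B ⁻¹) ⟨ - 1# ⟩ *ᶜ γ)                 ≈⟨ *ᶜ-congʳ (⟨-1⟩² C) ⟨
      γ *ᶜ γ *ᶜ ((B ⁻¹) ⟨ - 1# ⟩ *ᶜ γ)             ≈⟨ solve 2 (λ c b → (c ⊕ c) ⊕ (b ⊕ c) ⊜ c ⊕ ((b ⊕ c) ⊕ c)) reflᶜ γ ((B ⁻¹) ⟨ - 1# ⟩) ⟩
      γ *ᶜ ((B ⁻¹) ⟨ - 1# ⟩ *ᶜ γ *ᶜ γ)             ≈⟨ *ᶜ-congˡ (*ᶜ-congʳ (transᶜ (B′≐ (- 1#)) (·-⟨⟩ (B ⁻¹) C (- 1#)))) ⟨
      γ *ᶜ (B′ ⟨ - 1# ⟩ *ᶜ γ)                      ≈⟨ *ᶜ-congˡ (·-⟨⟩ B′ C (- 1#)) ⟨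
      γ *ᶜ s                                       ∎

  integrand-ext : ∀ {m} A (B C : Vector X m) x z → Extensional F (integrand A B C x z)
  integrand-ext A B C x z s t s≈t = *ᶜ-cong
    (∏ᶜ.sum-cong-≋ (λ i → weight-cong (B i) (C i) {x i} reflᶜ (s≈t i)))
    (⟨⟩-cong (A ⁻¹) (+-congˡ (-‿cong (∑-cong (λ i → *-congˡ (s≈t i))))))

  Φ-cong : ∀ {m} A (B C : Vector X m) x {w z} → w ≈ z → Φ m A B C x w ≈ᶜ Φ m A B C x z
  Φ-cong {m} A B C x w≈z = ∑Fᵐ-cong F m (λ t → *ᶜ-congˡ (⟨⟩-cong (A ⁻¹) (+-congʳ w≈z)))

  x-[y+z]≈[x-y]-z : ∀ x y z → x - (y + z) ≈ x - y - z
  x-[y+z]≈[x-y]-z x y z = trans (+-congˡ (sym (-‿+-comm y z))) (sym (+-assoc x (- y) (- z)))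

  Φ-peel : ∀ {m} k A (B C : Vector X (suc m)) x z → Φ (suc m) A B C x z ≈ᶜ
           ∑F (λ t → weight (B k) (C k) (x k) t *ᶜ Φ m A (removeAt B k) (removeAt C k) (removeAt x k) (z - x k * t))
  Φ-peel {m} k A B C x z = transᶜ
    (∑Fᵐ-insertAt F k (integrand A B C x z) (integrand-ext A B C x z))
    (∑F-cong F λ t → transᶜ (∑Fᵐ-cong F m (λ ts → step t ts))
      (symᶜ (*-distribˡ-∑Fᵐ F m (weight (B k) (C k) (x k) t) _)))
    where
    open SetoidReasoning ℂ-ring.setoid
    step : ∀ t ts → integrand A B C x z (insertAt ts k t) ≈ᶜ
      weight (B k) (C k) (x k) t *ᶜ integrand A (removeAt B k) (removeAt C k) (removeAt x k) (z - x k * t) ts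
    step t ts = begin
      ∏ᶜ.sum w *ᶜ (A ⁻¹) ⟨ z - ∑ u ⟩
        ≈⟨ *ᶜ-cong (∏ᶜ.sum-remove {i = k} w) (⟨⟩-cong (A ⁻¹)
             (trans (+-congˡ (-‿cong (∑-remove {i = k} u))) (x-[y+z]≈[x-y]-z z (u k) (∑ (removeAt u k))))) ⟩
      w k *ᶜ ∏ᶜ.sum (removeAt w k) *ᶜ (A ⁻¹) ⟨ z - u k - ∑ (removeAt u k) ⟩
        ≈⟨ ℂ-ring.*-assoc _ _ _ ⟩
      w k *ᶜ (∏ᶜ.sum (removeAt w k) *ᶜ (A ⁻¹) ⟨ z - u k - ∑ (removeAt u k) ⟩)
        ≈⟨ *ᶜ-cong (weight-cong (B k) (C k) {x k} reflᶜ at-k)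
             (*ᶜ-cong (∏ᶜ.sum-cong-≋ (λ j → weight-cong (B (punchIn k j)) (C (punchIn k j)) {x (punchIn k j)} reflᶜ (off-k j)))
               (⟨⟩-cong (A ⁻¹) (+-cong (+-congˡ (-‿cong (*-congˡ at-k))) (-‿cong (∑-cong (λ j → *-congˡ (off-k j))))))) ⟩
      weight (B k) (C k) (x k) t *ᶜ integrand A (removeAt B k) (removeAt C k) (removeAt x k) (z - x k * t) ts
        ∎
      where
      s : Vector Carrier (suc m)
      s = insertAt ts k t
      w : Vector ℂ (suc m)
      w i = weight (B i) (C i) (x i) (s i)
      u : Vector Carrier (suc m)
      u i = x i * s i
      at-k : s k ≈ t
      at-k = reflexive (insertAt-lookup ts k t)
      off-k : ∀ j → s (punchIn k j) ≈ ts j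
      off-k j = reflexive (insertAt-punchIn ts k t j)

  F-A′ : ∀ m → X → (B C : Vector X m) → Vector Carrier m → ℂ
  F-A′ m A B C x = Φ m A B C x 1#

  -- Multiplying the argument of Ā by s turns the constant into 1. The weights do not notice that
  -- `x i` became `x i * s`, since s is a unit.
  Φ-rescale : ∀ {m} A (B C : Vector X m) x {s z} → ¬ s ≈ 0# → s * z ≈ 1# →
              Φ m A B C x z ≈ᶜ A ⟨ s ⟩ *ᶜ F-A′ m A B C (λ i → x i * s)
  Φ-rescale {m} A B C x {s} {z} s≉0 sz≈1 = transᶜ (∑Fᵐ-cong F m step) (symᶜ (*-distribˡ-∑Fᵐ F m (A ⟨ s ⟩) _))
    where
    open CommutativeSemigroupProperties ℂ-ring.*-commutativeSemigroup using (x∙yz≈y∙xz)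
    argument : ∀ t → s * (z - ∑ (λ i → x i * t i)) ≈ 1# - ∑ (λ i → x i * s * t i)
    argument t = begin
      s * (z - ∑ (λ i → x i * t i))           ≈⟨ x[y-z]≈xy-xz s z _ ⟩
      s * z - s * ∑ (λ i → x i * t i)         ≈⟨ +-cong sz≈1 (-‿cong (*-distribˡ-∑ s (λ i → x i * t i))) ⟩
      1# - ∑ (λ i → s * (x i * t i))          ≈⟨ +-congˡ (-‿cong (∑-cong (λ i → trans (sym (*-assoc s (x i) (t i))) (*-congʳ (*-comm s (x i)))))) ⟩
      1# - ∑ (λ i → x i * s * t i)            ∎
      where open SetoidReasoning setoid
    step : ∀ t → integrand A B C x z t ≈ᶜ A ⟨ s ⟩ *ᶜ integrand A B C (λ i → x i * s) 1# t
    step t = transᶜ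
      (*ᶜ-cong (∏ᶜ.sum-cong-≋ (λ i → weight-cong (B i) (C i) (symᶜ (ε-absorbs-unit (x i) s≉0)) (refl {t i})))
        (⁻¹-⟨⟩-rescale A s≉0 (argument t)))
      (x∙yz≈y∙xz _ (A ⟨ s ⟩) _)

  -- The constant and the l-th term merge: 1 - y_l t′_l = 1 - (1 - t_l) = t_l. Matching the other
  -- terms after factoring out -x_l forces y_i = -x_i/x_l, stated here without division.
  ∑-reflect : ∀ {m} l (x y t t′ : Vector Carrier (suc m)) →
              y l ≈ 1# → (∀ i → i ≢ l → - x l * y i ≈ x i) →
              t′ l ≈ 1# - t l → (∀ i → i ≢ l → t′ i ≈ t i) →
              - x l * (1# - ∑ (λ i → y i * t′ i)) ≈ 0# - ∑ (λ i → x i * t i)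
  ∑-reflect l x y t t′ yₗ≈1 yᵢ t′ₗ t′ᵢ = begin
    - x l * (1# - ∑ u′)                               ≈⟨ *-congˡ (trans (+-congˡ (-‿cong (∑-remove {i = l} u′))) (x-[y+z]≈[x-y]-z 1# (u′ l) _)) ⟩
    - x l * (1# - u′ l - ∑ (removeAt u′ l))           ≈⟨ x[y-z]≈xy-xz (- x l) _ _ ⟩
    - x l * (1# - u′ l) - - x l * ∑ (removeAt u′ l)   ≈⟨ +-cong uₗ (-‿cong (trans (*-distribˡ-∑ (- x l) (removeAt u′ l)) (∑-cong (λ j → uᵢ (punchIn l j) (Fin.punchInᵢ≢i l j))))) ⟩
    - u l - ∑ (removeAt u l)                          ≈⟨ -‿+-comm (u l) _ ⟩
    - (u l + ∑ (removeAt u l))                        ≈⟨ -‿cong (∑-remove {i = l} u) ⟨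
    - ∑ u                                             ≈⟨ +-identityˡ _ ⟨
    0# - ∑ u                                          ∎
    where
    open SetoidReasoning setoid
    u u′ : Vector Carrier _
    u i = x i * t i
    u′ i = y i * t′ i
    uₗ : - x l * (1# - u′ l) ≈ - u l
    uₗ = trans (sym (-‿distribˡ-* (x l) _)) (-‿cong (*-congˡ
      (trans (+-congˡ (-‿cong (trans (*-cong yₗ≈1 t′ₗ) (*-identityˡ _)))) (1-[1-x]≈x F (t l)))))
    uᵢ : ∀ i → i ≢ l → - x l * u′ i ≈ u i
    uᵢ i i≢l = trans (sym (*-assoc _ (y i) (t′ i))) (*-cong (yᵢ i i≢l) (t′ᵢ i i≢l))

  -- The degenerate constant 0 is invariant under scaling, so the constant 1 has to come from
  -- reflecting the l-th variable. The factor Ā(-x_l) is what is pulled out of the argument.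
  Φ-zero : ∀ {m} l A (B B′ C : Vector X (suc m)) (x y : Vector Carrier (suc m)) → ¬ x l ≈ 0# →
           B′ l ≐ ((B l ⁻¹) · C l) → (∀ i → i ≢ l → B′ i ≡ B i) →
           y l ≈ 1# → (∀ i → i ≢ l → - x l * y i ≈ x i) →
           Φ (suc m) A B C x 0# ≈ᶜ (A ⁻¹) ⟨ - x l ⟩ *ᶜ C l ⟨ - 1# ⟩ *ᶜ F-A′ (suc m) A B′ C y
  Φ-zero {m} l A B B′ C x y xₗ≉0 B′ₗ B′ᵢ yₗ≈1 yᵢ = begin
    Φ (suc m) A B C x 0#
      ≈⟨ ∑Fᵐ-cong F (suc m) step ⟩
    ∑Fᵐ (suc m) (λ t → κ *ᶜ integrand A B′ C y 1# (updateAt t l (Inverse.to (reflection F))))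
      ≈⟨ *-distribˡ-∑Fᵐ F (suc m) κ (λ t → integrand A B′ C y 1# (updateAt t l (λ s → 1# - s))) ⟨
    κ *ᶜ ∑Fᵐ (suc m) (λ t → integrand A B′ C y 1# (updateAt t l (Inverse.to (reflection F))))
      ≈⟨ *ᶜ-congˡ (∑Fᵐ-permuteAt F l (integrand A B′ C y 1#) (integrand-ext A B′ C y 1#) (reflection F)) ⟨
    κ *ᶜ F-A′ (suc m) A B′ C y
      ∎
    where
    open SetoidReasoning ℂ-ring.setoid
    open CommutativeSemigroupProperties ℂ-ring.*-commutativeSemigroup using (interchange)
    κ : ℂ
    κ = (A ⁻¹) ⟨ - x l ⟩ *ᶜ C l ⟨ - 1# ⟩
    yₗ≉0 : ¬ y l ≈ 0#
    yₗ≉0 yₗ≈0 = 0≉1 (trans (sym yₗ≈0) yₗ≈1)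
    step : ∀ t → integrand A B C x 0# t ≈ᶜ κ *ᶜ integrand A B′ C y 1# (updateAt t l (λ s → 1# - s))
    step t = begin
      ∏ᶜ.sum w *ᶜ (A ⁻¹) ⟨ 0# - ∑ u ⟩              ≈⟨ *ᶜ-cong product argument ⟩
      (C l ⟨ - 1# ⟩ *ᶜ ∏ᶜ.sum w′) *ᶜ ((A ⁻¹) ⟨ - x l ⟩ *ᶜ (A ⁻¹) ⟨ 1# - ∑ u′ ⟩) ≈⟨ interchange _ _ _ _ ⟩
      (C l ⟨ - 1# ⟩ *ᶜ (A ⁻¹) ⟨ - x l ⟩) *ᶜ (∏ᶜ.sum w′ *ᶜ (A ⁻¹) ⟨ 1# - ∑ u′ ⟩) ≈⟨ *ᶜ-congʳ (ℂ-ring.*-comm _ _) ⟩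
      κ *ᶜ (∏ᶜ.sum w′ *ᶜ (A ⁻¹) ⟨ 1# - ∑ u′ ⟩)     ∎
      where
      t′ : Vector Carrier (suc m)
      t′ = updateAt t l (λ s → 1# - s)
      w w′ : Vector ℂ (suc m)
      w i = weight (B i) (C i) (x i) (t i)
      w′ i = weight (B′ i) (C i) (y i) (t′ i)
      u u′ : Vector Carrier (suc m)
      u i = x i * t i
      u′ i = y i * t′ i
      t′ₗ : t′ l ≈ 1# - t l
      t′ₗ = reflexive (updateAt-updates l t)
      t′ᵢ : ∀ i → i ≢ l → t′ i ≈ t i
      t′ᵢ i i≢l = reflexive (updateAt-minimal i l t i≢l)
      wₗ : w l ≈ᶜ C l ⟨ - 1# ⟩ *ᶜ w′ l
      wₗ = transᶜ (weight-reflect (B l) (C l) (B′ l) (t l) B′ₗ xₗ≉0 yₗ≉0)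
        (*ᶜ-congˡ (weight-cong (B′ l) (C l) {y l} reflᶜ (sym t′ₗ)))
      -- `x i` is `y i` times the unit `- x l`, so both vanish together and no case distinction on
      -- `x i` is needed.
      εᵢ : ∀ i → i ≢ l → ε ⟨ x i ⟩ ≈ᶜ ε ⟨ y i ⟩
      εᵢ i i≢l = transᶜ (⟨⟩-cong ε (trans (sym (yᵢ i i≢l)) (*-comm _ (y i)))) (ε-absorbs-unit (y i) (-≉0 F xₗ≉0))
      wᵢ : ∀ i → i ≢ l → w i ≈ᶜ w′ i
      wᵢ i i≢l = transᶜ (weight-cong (B i) (C i) (εᵢ i i≢l) (sym (t′ᵢ i i≢l)))
        (ℂ-ring.reflexive (≡.cong (λ b → weight b (C i) (y i) (t′ i)) (≡.sym (B′ᵢ i i≢l))))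
      product : ∏ᶜ.sum w ≈ᶜ C l ⟨ - 1# ⟩ *ᶜ ∏ᶜ.sum w′
      product = begin
        ∏ᶜ.sum w                                           ≈⟨ ∏ᶜ.sum-remove {i = l} w ⟩
        w l *ᶜ ∏ᶜ.sum (removeAt w l)                       ≈⟨ *ᶜ-cong wₗ (∏ᶜ.sum-cong-≋ (λ j → wᵢ (punchIn l j) (Fin.punchInᵢ≢i l j))) ⟩
        C l ⟨ - 1# ⟩ *ᶜ w′ l *ᶜ ∏ᶜ.sum (removeAt w′ l)     ≈⟨ ℂ-ring.*-assoc _ _ _ ⟩
        C l ⟨ - 1# ⟩ *ᶜ (w′ l *ᶜ ∏ᶜ.sum (removeAt w′ l))   ≈⟨ *ᶜ-congˡ (∏ᶜ.sum-remove {i = l} w′) ⟨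
        C l ⟨ - 1# ⟩ *ᶜ ∏ᶜ.sum w′                          ∎
      argument : (A ⁻¹) ⟨ 0# - ∑ u ⟩ ≈ᶜ (A ⁻¹) ⟨ - x l ⟩ *ᶜ (A ⁻¹) ⟨ 1# - ∑ u′ ⟩
      argument = transᶜ (⟨⟩-cong (A ⁻¹) (sym (∑-reflect l x y t t′ yₗ≈1 yᵢ t′ₗ t′ᵢ))) (⟨⟩-* (A ⁻¹) (- x l) _)

  -- Here l indexes the variables left after removing k, so that `punchIn k l` differs from k by
  -- construction. `B′` and `y` enter through their defining equations, the form in which the
  -- degenerate term uses them.
  reduction : ∀ {m} A (B C : Vector X (2 ℕ.+ m)) x k l → ¬ x (punchIn k l) ≈ 0# →
              (B′ : Vector X (suc m)) (y : Vector Carrier (suc m)) →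
              B′ l ≐ ((B (punchIn k l) ⁻¹) · C (punchIn k l)) → (∀ i → i ≢ l → B′ i ≡ B (punchIn k i)) →
              y l ≈ 1# → (∀ i → i ≢ l → - x (punchIn k l) * y i ≈ x (punchIn k i)) →
              F-A′ (2 ℕ.+ m) A B C x
                ≈ᶜ
              ((B k · C k) ⟨ - 1# ⟩ /q) *ᶜ ((B k ⁻¹) · C k) ⟨ x k - 1# ⟩ *ᶜ (C k ⁻¹) ⟨ x k ⟩
                *ᶜ (A ⁻¹) ⟨ - x (punchIn k l) ⟩ *ᶜ C (punchIn k l) ⟨ - 1# ⟩
                *ᶜ F-A′ (suc m) A B′ (removeAt C k) y
              +ᶜ
              ((B k · C k) ⟨ - 1# ⟩ *ᶜ (C k ⁻¹) ⟨ x k ⟩) /q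
                *ᶜ ∑F (λ s → (A · (C k ⁻¹)) ⟨ s ⟩ *ᶜ B k ⟨ s - 1# ⟩
                       *ᶜ ((B k ⁻¹) · C k) ⟨ 1# - s + x k * s ⟩
                       *ᶜ F-A′ (suc m) A (removeAt B k) (removeAt C k) (removeAt (λ i → x i * s) k))
  reduction {m} A B C x k l xₗ≉0 B′ y B′ₗ B′ᵢ yₗ≈1 yᵢ = by-cases (x k ≟ 0#)
    where
    open SetoidReasoning ℂ-ring.setoid
    xₖ : Carrier
    xₖ = x k
    Bₖ Cₖ : X
    Bₖ = B k
    Cₖ = C k
    φ : Carrier → ℂ
    φ = Φ (suc m) A (removeAt B k) (removeAt C k) (removeAt x k)
    fₗ : ℂ
    fₗ = F-A′ (suc m) A B′ (removeAt C k) y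
    f g h : Carrier → ℂ
    f s = F-A′ (suc m) A (removeAt B k) (removeAt C k) (removeAt (λ i → x i * s) k)
    g t = weight Bₖ Cₖ xₖ t *ᶜ φ (1# - xₖ * t)
    h s = (A · (Cₖ ⁻¹)) ⟨ s ⟩ *ᶜ Bₖ ⟨ s - 1# ⟩ *ᶜ ((Bₖ ⁻¹) · Cₖ) ⟨ 1# - s + xₖ * s ⟩ *ᶜ f s
    bc c̄ ā cₗ κ first second : ℂ
    bc = (Bₖ · Cₖ) ⟨ - 1# ⟩
    c̄ = (Cₖ ⁻¹) ⟨ xₖ ⟩
    ā = (A ⁻¹) ⟨ - x (punchIn k l) ⟩
    cₗ = C (punchIn k l) ⟨ - 1# ⟩
    κ = (bc *ᶜ c̄) /q
    first = (bc /q) *ᶜ ((Bₖ ⁻¹) · Cₖ) ⟨ xₖ - 1# ⟩ *ᶜ c̄ *ᶜ ā *ᶜ cₗ *ᶜ fₗ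
    second = κ *ᶜ ∑F h
    1/q : ℂ
    1/q = ratᶜ ((+ 1 ℚ./ q) {{q≢0}})

    by-cases : Dec (xₖ ≈ 0#) → F-A′ (2 ℕ.+ m) A B C x ≈ᶜ first +ᶜ second
    by-cases (yes xₖ≈0) = begin
      F-A′ (2 ℕ.+ m) A B C x    ≈⟨ Φ-peel k A B C x 1# ⟩
      ∑F g                      ≈⟨ ∑F-cong F (λ t → transᶜ (*ᶜ-congʳ (weight-zero Bₖ Cₖ t xₖ≈0)) (ℂ-ring.zeroˡ (φ (1# - xₖ * t)))) ⟩
      ∑F (λ _ → 0ᶜ)             ≈⟨ ∑F-zero F ⟩
      0ᶜ                        ≈⟨ ℂ-ring.+-identityˡ 0ᶜ ⟨
      0ᶜ +ᶜ 0ᶜ                  ≈⟨ +ᶜ-cong first≈0 second≈0 ⟨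
      first +ᶜ second           ∎
      where
      c̄≈0 : c̄ ≈ᶜ 0ᶜ
      c̄≈0 = ⟨⟩-zero (Cₖ ⁻¹) xₖ≈0
      first≈0 : first ≈ᶜ 0ᶜ
      first≈0 = transᶜ (solve 6 (λ r d c a e f → ((((r ⊕ d) ⊕ c) ⊕ a) ⊕ e) ⊕ f ⊜ c ⊕ ((((r ⊕ d) ⊕ a) ⊕ e) ⊕ f))
           reflᶜ (bc /q) (((Bₖ ⁻¹) · Cₖ) ⟨ xₖ - 1# ⟩) c̄ ā cₗ fₗ)
        (transᶜ (*ᶜ-congʳ c̄≈0) (ℂ-ring.zeroˡ _))
      second≈0 : second ≈ᶜ 0ᶜ
      second≈0 = transᶜ (solve 4 (λ b c r f → ((b ⊕ c) ⊕ r) ⊕ f ⊜ c ⊕ ((b ⊕ r) ⊕ f)) reflᶜ bc c̄ 1/q (∑F h))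
        (transᶜ (*ᶜ-congʳ c̄≈0) (ℂ-ring.zeroˡ _))
    by-cases (no xₖ≉0) = begin
      F-A′ (2 ℕ.+ m) A B C x        ≈⟨ Φ-peel k A B C x 1# ⟩
      ∑F g                          ≈⟨ ∑F-permute F g g-cong π ⟩
      ∑F (g ∘ τ)                    ≈⟨ ∑F-extract-zero F (g ∘ τ) (λ s → κ *ᶜ h s) (λ s≈t → g-cong (Inverse.to-cong π s≈t)) κh-zero gτ≈κh ⟩
      g (τ 0#) +ᶜ ∑F (λ s → κ *ᶜ h s)  ≈⟨ +ᶜ-cong gτ0≈first (symᶜ (*-distribˡ-∑F F κ h)) ⟩
      first +ᶜ second               ∎
      where
      g-cong : ∀ {s t} → s ≈ t → g s ≈ᶜ g t
      g-cong s≈t = *ᶜ-cong (weight-cong Bₖ Cₖ {xₖ} reflᶜ s≈t)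
        (Φ-cong A (removeAt B k) (removeAt C k) (removeAt x k) (+-congˡ (-‿cong (*-congˡ s≈t))))
      -- The substitution solved for t, namely t = (1 - 1/s)/x_k, composed from three bijections; at
      -- s = 0 it gives t = 1/x_k.
      π : Permutationᶠ F
      π = Composition.inverse (inversion F) (Composition.inverse (reflection F) (dilation F (recipˡ F xₖ≉0)))
      τ : Carrier → Carrier
      τ = Inverse.to π
      xₖτ : ∀ s → xₖ * τ s ≈ 1# - inv F s
      xₖτ s = trans (sym (*-assoc xₖ _ _)) (trans (*-congʳ (recipʳ F xₖ≉0)) (*-identityˡ _))
      1-xₖτ : ∀ s → 1# - xₖ * τ s ≈ inv F s
      1-xₖτ s = trans (+-congˡ (-‿cong (xₖτ s))) (1-[1-x]≈x F (inv F s))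
      xₖτ0 : xₖ * τ 0# ≈ 1#
      xₖτ0 = trans (xₖτ 0#) (trans (+-congˡ (trans (-‿cong (inv-zero F refl)) -0#≈0#)) (+-identityʳ 1#))
      -- Every character vanishes at 0, the trivial one included, so this holds even when A and C_k
      -- coincide.
      κh-zero : ∀ {s} → s ≈ 0# → κ *ᶜ h s ≈ᶜ 0ᶜ
      κh-zero {s} s≈0 = transᶜ (solve 5 (λ κ a b d f → κ ⊕ (((a ⊕ b) ⊕ d) ⊕ f) ⊜ a ⊕ (((κ ⊕ b) ⊕ d) ⊕ f))
           reflᶜ κ ((A · (Cₖ ⁻¹)) ⟨ s ⟩) (Bₖ ⟨ s - 1# ⟩) (((Bₖ ⁻¹) · Cₖ) ⟨ 1# - s + xₖ * s ⟩) (f s))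
        (transᶜ (*ᶜ-congʳ (⟨⟩-zero (A · (Cₖ ⁻¹)) s≈0)) (ℂ-ring.zeroˡ _))
      gτ0≈first : g (τ 0#) ≈ᶜ first
      gτ0≈first = begin
        weight Bₖ Cₖ xₖ (τ 0#) *ᶜ φ (1# - xₖ * τ 0#)
          -- With w = x_k and t = 1/x_k the scaled arguments are wt = 1 and w(1 - t) = x_k - 1.
          ≈⟨ *ᶜ-cong (weight-rescale Bₖ Cₖ (τ 0#) xₖ≉0 xₖ≉0)
               (transᶜ (Φ-cong A (removeAt B k) (removeAt C k) (removeAt x k) (trans (1-xₖτ 0#) (inv-zero F refl)))
                 (Φ-zero l A (removeAt B k) B′ (removeAt C k) (removeAt x k) y xₗ≉0 B′ₗ B′ᵢ yₗ≈1 yᵢ)) ⟩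
        (bc /q) *ᶜ (c̄ *ᶜ Bₖ ⟨ xₖ * τ 0# ⟩ *ᶜ ((Bₖ ⁻¹) · Cₖ) ⟨ xₖ * (1# - τ 0#) ⟩) *ᶜ (ā *ᶜ cₗ *ᶜ fₗ)
          ≈⟨ *ᶜ-congʳ (*ᶜ-congˡ (*ᶜ-cong (transᶜ (*ᶜ-congˡ (⟨1⟩ Bₖ xₖτ0)) (ℂ-ring.*-identityʳ c̄))
               (⟨⟩-cong ((Bₖ ⁻¹) · Cₖ) (trans (x[y-z]≈xy-xz xₖ 1# (τ 0#)) (+-cong (*-identityʳ xₖ) (-‿cong xₖτ0)))))) ⟩
        (bc /q) *ᶜ (c̄ *ᶜ ((Bₖ ⁻¹) · Cₖ) ⟨ xₖ - 1# ⟩) *ᶜ (ā *ᶜ cₗ *ᶜ fₗ)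
          ≈⟨ solve 6 (λ r c d a e f → (r ⊕ (c ⊕ d)) ⊕ ((a ⊕ e) ⊕ f) ⊜ ((((r ⊕ d) ⊕ c) ⊕ a) ⊕ e) ⊕ f) reflᶜ (bc /q) c̄ (((Bₖ ⁻¹) · Cₖ) ⟨ xₖ - 1# ⟩) ā cₗ fₗ ⟩
        first
          ∎
      gτ≈κh : ∀ {s} → ¬ s ≈ 0# → g (τ s) ≈ᶜ κ *ᶜ h s
      gτ≈κh {s} s≉0 = begin
        weight Bₖ Cₖ xₖ (τ s) *ᶜ φ (1# - xₖ * τ s)
          -- Here t = (s - 1)/(x_k s), so w = x_k s gives wt = s - 1 and w(1 - t) = 1 - s + x_k s.
          ≈⟨ *ᶜ-cong (weight-rescale Bₖ Cₖ (τ s) xₖ≉0 (*-≉0 F xₖ≉0 s≉0))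
               (Φ-rescale A (removeAt B k) (removeAt C k) (removeAt x k) s≉0 (trans (*-congˡ (1-xₖτ s)) (*-inv F s≉0))) ⟩
        (bc /q) *ᶜ ((Cₖ ⁻¹) ⟨ xₖ * s ⟩ *ᶜ Bₖ ⟨ xₖ * s * τ s ⟩ *ᶜ ((Bₖ ⁻¹) · Cₖ) ⟨ xₖ * s * (1# - τ s) ⟩) *ᶜ (A ⟨ s ⟩ *ᶜ f s)
          ≈⟨ *ᶜ-congʳ (*ᶜ-congˡ (*ᶜ-cong (*ᶜ-cong (⟨⟩-* (Cₖ ⁻¹) xₖ s) (⟨⟩-cong Bₖ w*τ)) (⟨⟩-cong ((Bₖ ⁻¹) · Cₖ) w*[1-τ]))) ⟩
        (bc /q) *ᶜ (c̄ *ᶜ (Cₖ ⁻¹) ⟨ s ⟩ *ᶜ Bₖ ⟨ s - 1# ⟩ *ᶜ ((Bₖ ⁻¹) · Cₖ) ⟨ 1# - s + xₖ * s ⟩) *ᶜ (A ⟨ s ⟩ *ᶜ f s)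
          ≈⟨ solve 8 (λ u r c c′ b d a f → ((u ⊕ r) ⊕ (((c ⊕ c′) ⊕ b) ⊕ d)) ⊕ (a ⊕ f) ⊜ ((u ⊕ c) ⊕ r) ⊕ ((((a ⊕ c′) ⊕ b) ⊕ d) ⊕ f))
               reflᶜ bc 1/q c̄ ((Cₖ ⁻¹) ⟨ s ⟩) (Bₖ ⟨ s - 1# ⟩) (((Bₖ ⁻¹) · Cₖ) ⟨ 1# - s + xₖ * s ⟩) (A ⟨ s ⟩) (f s) ⟩
        κ *ᶜ (A ⟨ s ⟩ *ᶜ (Cₖ ⁻¹) ⟨ s ⟩ *ᶜ Bₖ ⟨ s - 1# ⟩ *ᶜ ((Bₖ ⁻¹) · Cₖ) ⟨ 1# - s + xₖ * s ⟩ *ᶜ f s)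
          ≈⟨ *ᶜ-congˡ (*ᶜ-congʳ (*ᶜ-congʳ (*ᶜ-congʳ (·-⟨⟩ A (Cₖ ⁻¹) s)))) ⟨
        κ *ᶜ h s
          ∎
        where
        w*τ : xₖ * s * τ s ≈ s - 1#
        w*τ = trans (trans (*-congʳ (*-comm xₖ s)) (*-assoc s xₖ (τ s))) (trans (*-congˡ (xₖτ s))
          (trans (x[y-z]≈xy-xz s 1# (inv F s)) (+-cong (*-identityʳ s) (-‿cong (*-inv F s≉0)))))
        w*[1-τ] : xₖ * s * (1# - τ s) ≈ 1# - s + xₖ * s
        w*[1-τ] = trans (x[y-z]≈xy-xz (xₖ * s) 1# (τ s)) (trans (+-cong (*-identityʳ _) (-‿cong w*τ))
          (trans (+-congˡ (⁻¹-anti-homo‿- s 1#)) (+-comm (xₖ * s) (1# - s))))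

  -- As k and l differ, l is `punchIn k l′` for a unique l′, and matching on that equation
  -- eliminates l. The map `g` is constrained only by the values of `g (B l)`, so the concrete
  -- character put there is never unfolded.
  lauricella-reduction :
    ∀ n → 2 ℕ.≤ suc n → ∀ A (B C : Vector X (suc n)) (x : Vector Carrier (suc n)) k l →
    k ≢ l → (xₗ≉0 : ¬ x l ≈ 0#) → (g : X → X) → g (B l) ≐ ((B l ⁻¹) · C l) →
    F-A′ (suc n) A B C x
      ≈ᶜ
    ((B k · C k) ⟨ - 1# ⟩ /q) *ᶜ ((B k ⁻¹) · C k) ⟨ x k - 1# ⟩ *ᶜ (C k ⁻¹) ⟨ x k ⟩
      *ᶜ (A ⁻¹) ⟨ - x l ⟩ *ᶜ C l ⟨ - 1# ⟩
      *ᶜ F-A′ n A (removeAt (updateAt B l g) k) (removeAt C k)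
           (removeAt (updateAt (λ i → - (x i * recip (x l) xₗ≉0)) l (λ _ → 1#)) k)
    +ᶜ
    ((B k · C k) ⟨ - 1# ⟩ *ᶜ (C k ⁻¹) ⟨ x k ⟩) /q
      *ᶜ ∑F (λ s → (A · (C k ⁻¹)) ⟨ s ⟩ *ᶜ B k ⟨ s - 1# ⟩
             *ᶜ ((B k ⁻¹) · C k) ⟨ 1# - s + x k * s ⟩
             *ᶜ F-A′ n A (removeAt B k) (removeAt C k) (removeAt (λ i → x i * s) k))
  lauricella-reduction ℕ.zero (s≤s ())
  lauricella-reduction (suc m) _ A B C x k l k≢l xₗ≉0 g gₗ = at-punchIn (punchOut k≢l) (Fin.punchIn-punchOut k≢l)
    where
    y : Vector Carrier (2 ℕ.+ m)
    y = updateAt (λ i → - (x i * recip (x l) xₗ≉0)) l (λ _ → 1#)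
    off-l : ∀ j → punchIn k j ≢ l → - x l * y (punchIn k j) ≈ x (punchIn k j)
    off-l j kj≢l = begin
      - x l * y (punchIn k j)              ≡⟨ ≡.cong (- x l *_) (updateAt-minimal (punchIn k j) l _ kj≢l) ⟩
      - x l * - (xⱼ * recip (x l) xₗ≉0)    ≈⟨ trans (sym (-‿distribˡ-* (x l) _)) (-‿cong (sym (-‿distribʳ-* (x l) _))) ⟩
      - - (x l * (xⱼ * recip (x l) xₗ≉0))  ≈⟨ -‿involutive _ ⟩
      x l * (xⱼ * recip (x l) xₗ≉0)        ≈⟨ *-comm (x l) _ ⟩
      xⱼ * recip (x l) xₗ≉0 * x l          ≈⟨ *-assoc xⱼ _ (x l) ⟩
      xⱼ * (recip (x l) xₗ≉0 * x l)        ≈⟨ *-congˡ (recipˡ F xₗ≉0) ⟩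
      xⱼ * 1#                              ≈⟨ *-identityʳ xⱼ ⟩
      xⱼ                                   ∎
      where
      open SetoidReasoning setoid
      xⱼ : Carrier
      xⱼ = x (punchIn k j)
    at-punchIn : ∀ l′ → punchIn k l′ ≡ l → _
    at-punchIn l′ ≡.refl = reduction A B C x k l′ xₗ≉0 (removeAt (updateAt B l g) k) (removeAt y k)
      (λ v → transᶜ (ℂ-ring.reflexive (≡.cong (_⟨ v ⟩) (updateAt-updates l B))) (gₗ v))
      (λ j j≢l′ → updateAt-minimal (punchIn k j) l B (j≢l′ ∘ Fin.punchIn-injective k j l′))
      (reflexive (updateAt-updates l _))
      (λ j j≢l′ → off-l j (j≢l′ ∘ Fin.punchIn-injective k j l′))

-- Transfer to the actual multiplicative characters.

module _ {c ℓ : Level} {q : ℕ} (F : FiniteField c ℓ q) where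

  open FiniteField F
  open Lauricella F
  open GroupHomomorphism using (⟦_⟧)
  open MultiplicativeCharacters F using (⟨⟩-unit; ⟨⟩-zero; isCharacterGroup)

  _≋_ : Character → Character → Set (c ⊔ ℓ)
  χ ≋ ψ = ∀ u → proj₁ (⟦ χ ⟧ u) ≈ᶜ proj₁ (⟦ ψ ⟧ u)

  -- At a variable index `updateAt` does not compute; induction on l and j reduces the comparison to
  -- the values of the one altered character.
  updateAt-≋ : ∀ {n} (B : Vector Character n) l g g′ → g (B l) ≋ g′ (B l) →
               ∀ j → updateAt B l g j ≋ updateAt B l g′ j
  updateAt-≋ B Fin.zero    g g′ g≋g′ Fin.zero    = g≋g′
  updateAt-≋ B Fin.zero    g g′ g≋g′ (Fin.suc j) = λ _ → reflᶜ
  updateAt-≋ B (Fin.suc l) g g′ g≋g′ Fin.zero    = λ _ → reflᶜ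
  updateAt-≋ B (Fin.suc l) g g′ g≋g′ (Fin.suc j) = updateAt-≋ (tail B) l g g′ g≋g′ j

  ≋⇒⟨⟩ : ∀ {χ ψ} → χ ≋ ψ → ∀ x → χ ⟨ x ⟩ ≈ᶜ ψ ⟨ x ⟩
  ≋⇒⟨⟩ {χ} {ψ} χ≋ψ x = by-cases (x ≟ 0#)
    where
    by-cases : Dec (x ≈ 0#) → χ ⟨ x ⟩ ≈ᶜ ψ ⟨ x ⟩
    by-cases (yes x≈0) = transᶜ (⟨⟩-zero χ x≈0) (symᶜ (⟨⟩-zero ψ x≈0))
    by-cases (no x≉0)  = transᶜ (⟨⟩-unit χ x≉0)
      (transᶜ (χ≋ψ (x , invertible x x≉0)) (symᶜ (⟨⟩-unit ψ x≉0)))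

  -- The value of `χ ⁻¹` at u is the inverse carried along by the unit `⟦ χ ⟧ u`. Equality of units
  -- compares first components, and uniqueness of inverses extends it to the second.
  updateAt-⁻¹-≋ : ∀ {n} (B : Vector Character n) l g g′ → g (B l) ≋ g′ (B l) →
                  ∀ j u → proj₁ (proj₂ (⟦ updateAt B l g j ⟧ u)) ≈ᶜ proj₁ (proj₂ (⟦ updateAt B l g′ j ⟧ u))
  updateAt-⁻¹-≋ B l g g′ g≋g′ j u =
    AbelianGroup.⁻¹-cong ℂˣ {⟦ updateAt B l g j ⟧ u} {⟦ updateAt B l g′ j ⟧ u} (updateAt-≋ B l g g′ g≋g′ j u)

theorem3p3 :
  ∀ {c ℓ} (p r : ℕ) → Prime p → ¬ (2 ∣ p) → 1 ℕ.≤ r →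
  (F : FiniteField c ℓ (p ℕ.^ r)) →
  let open FiniteField F
      open Lauricella F
  in
  (n-1 : ℕ) → 2 ℕ.≤ suc n-1 →
  (A : Character) (B C : Vector Character (suc n-1)) (x : Vector Carrier (suc n-1)) →
  (k l : Fin (suc n-1)) → k ≢ l → (xₗ≉0 : ¬ x l ≈ 0#) →
  let B′ = updateAt B l (λ Bₗ → Bₗ ⁻¹ · C l)
      y  = updateAt (λ i → - (x i * recip (x l) xₗ≉0)) l (λ _ → 1#)
  in
  F-A (suc n-1) A B C x
    ≈ᶜ
  ((B k · C k) ⟨ - 1# ⟩ /q) *ᶜ (B k ⁻¹ · C k) ⟨ x k - 1# ⟩ *ᶜ (C k ⁻¹) ⟨ x k ⟩
    *ᶜ (A ⁻¹) ⟨ - x l ⟩ *ᶜ C l ⟨ - 1# ⟩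
    *ᶜ F-A n-1 A (removeAt B′ k) (removeAt C k) (removeAt y k)
  +ᶜ
  ((B k · C k) ⟨ - 1# ⟩ *ᶜ (C k ⁻¹) ⟨ x k ⟩) /q
    *ᶜ ∑F (λ tₖ → (A · C k ⁻¹) ⟨ tₖ ⟩ *ᶜ B k ⟨ tₖ - 1# ⟩
                   *ᶜ (B k ⁻¹ · C k) ⟨ 1# - tₖ + x k * tₖ ⟩
                   *ᶜ F-A n-1 A (removeAt B k) (removeAt C k) (removeAt (λ i → x i * tₖ) k))
theorem3p3 p r _ _ _ F n-1 n≥2 A B C x k l k≢l xₗ≉0 = transᶜ
  (Reduction.lauricella-reduction F {X = Character} {_·_} {_⁻¹} {ε} {_⟨_⟩} isCharacterGroup
    n-1 n≥2 A B C x k l k≢l xₗ≉0 (λ Bₗ → Bₗ ⁻¹ · C l) (λ _ → reflᶜ))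
  -- Both sides are definitionally equal, but comparing the homomorphism proofs inside
  -- the characters is intractable, so they are identified value by value.
  (+ᶜ-cong
    (*ᶜ-cong
      (*ᶜ-cong (*ᶜ-cong (*ᶜ-cong (*ᶜ-cong
        (*ᶜ-congʳ (≋⇒⟨⟩ F (λ _ → reflᶜ) _))
        (≋⇒⟨⟩ F (λ _ → reflᶜ) _)) (≋⇒⟨⟩ F (λ _ → reflᶜ) _)) (≋⇒⟨⟩ F (λ _ → reflᶜ) _)) reflᶜ)
      (∑Fᵐ-cong F n-1 λ _ → *ᶜ-cong
        (∏ᶜ.sum-cong-≋ {n-1} λ j → *ᶜ-cong (*ᶜ-cong (*ᶜ-cong reflᶜ
          (*ᶜ-congʳ (≋⇒⟨⟩ F (λ u → *ᶜ-congʳ (updateAt-≋ F B l _ _ (λ _ → reflᶜ) (punchIn k j) u)) _)))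
          (≋⇒⟨⟩ F (updateAt-≋ F B l _ _ (λ _ → reflᶜ) (punchIn k j)) _))
          (≋⇒⟨⟩ F (λ u → *ᶜ-congʳ (updateAt-⁻¹-≋ F B l _ _ (λ _ → reflᶜ) (punchIn k j) u)) _))
        (≋⇒⟨⟩ F (λ _ → reflᶜ) _)))
    (*ᶜ-cong
      (*ᶜ-congʳ (*ᶜ-cong (≋⇒⟨⟩ F (λ _ → reflᶜ) _) (≋⇒⟨⟩ F (λ _ → reflᶜ) _)))
      (sum-cong-≋ {p ℕ.^ r} λ _ → *ᶜ-cong
        (*ᶜ-cong (*ᶜ-cong (≋⇒⟨⟩ F (λ _ → reflᶜ) _) reflᶜ) (≋⇒⟨⟩ F (λ _ → reflᶜ) _))
        (∑Fᵐ-cong F n-1 λ _ → *ᶜ-cong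
          (∏ᶜ.sum-cong-≋ {n-1} λ _ → *ᶜ-cong (*ᶜ-cong (*ᶜ-cong reflᶜ
            (*ᶜ-congʳ (≋⇒⟨⟩ F (λ _ → reflᶜ) _))) (≋⇒⟨⟩ F (λ _ → reflᶜ) _)) (≋⇒⟨⟩ F (λ _ → reflᶜ) _))
          (≋⇒⟨⟩ F (λ _ → reflᶜ) _)))))
  where
  open FiniteField F
  open Lauricella F
  open MultiplicativeCharacters F using (isCharacterGroup)
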